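{- For every finite simple graph $G$, the following are equivalent: (i) $A(G)=1$; (ii) $a^*(G)=1$; (iii) $G$ does not contain a fractional perfect matching.
   Context: For graphs $G,H$, the tensor product $G\times H$ has vertex set $V(G)\times V(H)$, with $(u,v)$ adjacent to $(u',v')$ iff $uu'\in E(G)$ and $vv'\in E(H)$; $G^n$ denotes the tensor product of $n$ copies of $G$. The independence ratio is $i(G)=\alpha(G)/|V(G)|$, and $A(G)=\lim_{n\to\infty} i(G^n)$ (the sequence is non-decreasing and bounded, so the limit exists). For a vertex set $I$, $N(I)$ is the set of vertices having a neighbor in $I$. Define $a(G)=\max_{I}\frac{|I|}{|I|+|N(I)|}$ over nonempty independent sets $I$ of $G$, and $a^*(G)=a(G)$ if $a(G)\le \frac12$, $a^*(G)=1$ if $a(G)>\frac12$. A fractional matching of $G=(V,E)$ is $f:E\to\mathbb{R}_{\ge 0}$ with $\sum_{e\ni v} f(e)\le 1$ for all $v\in V$; it is a fractional perfect matching if $\sum_{e\in E}f(e)=|V|/2$.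
   Formalization: Fractional matchings are taken with nonnegative rational values instead of nonnegative real values, so (iii) says that G has no rational-valued fractional perfect matching. -}

module Defs where

open import Data.Nat using (ℕ; zero; suc; _+_; _*_; _≤_; _<_)
open import Data.Nat.Properties using (_<?_)
open import Data.Bool using (Bool; true; false; _∧_; _∨_; not; if_then_else_)
open import Data.Fin using (Fin; toℕ)
open import Data.Fin.Subset using (Subset)
open import Data.List using (List; []; _∷_; map; concatMap; length; foldr; filter; allFin)
open import Data.Bool.ListAction using (any; all)
open import Data.Vec using (Vec; []; _∷_; lookup; toList; zipWith)
import Data.Vec as Vec
open import Data.Integer using (+_)
open import Data.Rational using (ℚ; _/_; 0ℚ; _⊔_) renaming (_+_ to _+ℚ_)
open import Relation.Binary.PropositionalEquality using (_≡_)
open import Data.Product using (Σ; _×_; _,_; proj₁; proj₂)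
open import Relation.Nullary.Decidable using (⌊_⌋)
open import Data.List.Membership.Propositional using (_∈_)
open import Function.Bundles using (_⇔_)

record Graph : Set where
  field
    n     : ℕ
    adj   : Fin n → Fin n → Bool
    sym   : ∀ u v → adj u v ≡ adj v u
    irrfl : ∀ v → adj v v ≡ false
open Graph public

-- a/b as a rational; b = 0 never occurs in the theorem (graphs nonempty)
ratio : ℕ → ℕ → ℚ
ratio a zero    = 0ℚ
ratio a (suc b) = (+ a) / suc b

maxℚ : List ℚ → ℚ
maxℚ = foldr _⊔_ 0ℚ

maxℕ : List ℕ → ℕ
maxℕ = foldr Data.Nat._⊔_ 0

sumℚ : List ℚ → ℚ
sumℚ = foldr _+ℚ_ 0ℚ

sublists : {A : Set} → List A → List (List A)
sublists []       = [] ∷ []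
sublists (x ∷ xs) = let s = sublists xs in concatMap (λ ys → ys ∷ (x ∷ ys) ∷ []) s

count : {A : Set} → (A → Bool) → List A → ℕ
count p xs = length (filter (λ x → Data.Bool._≟_ (p x) true) xs)

allVecs : (k m : ℕ) → List (Vec (Fin k) m)
allVecs k zero    = [] ∷ []
allVecs k (suc m) = concatMap (λ x → map (x ∷_) (allVecs k m)) (allFin k)

powAdj : (G : Graph) (m : ℕ) → Vec (Fin (n G)) m → Vec (Fin (n G)) m → Bool
powAdj G m x y = Vec.foldr _ _∧_ true (zipWith (adj G) x y)

independentL : {V : Set} → (V → V → Bool) → List V → Bool
independentL a I = all (λ x → all (λ y → not (a x y)) I) I

-- independence number α(G^m): maximum size of an independent set of G^m
-- (sets = sublists of the list of all vertices, which has no repetitions)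
αPow : (G : Graph) (m : ℕ) → ℕ
αPow G m = maxℕ (map length (filter (λ I → Data.Bool._≟_ (independentL (powAdj G m) I) true)
                                  (sublists (allVecs (n G) m))))

iPow : (G : Graph) (m : ℕ) → ℚ
iPow G m = ratio (αPow G m) (n G Data.Nat.^ m)

A≡1 : Graph → Set
A≡1 G = ∀ (ε : ℚ) → 0ℚ Data.Rational.< ε →
        Σ ℕ (λ N → ∀ m → N ≤ m → Data.Rational.∣ iPow G (suc m) Data.Rational.- Data.Rational.1ℚ ∣ Data.Rational.< ε)

∈S : {k : ℕ} → Subset k → Fin k → Bool
∈S S v = lookup S v

allSubsets : (k : ℕ) → List (Subset k)
allSubsets zero    = [] ∷ []
allSubsets (suc k) = concatMap (λ S → (false ∷ S) ∷ (true ∷ S) ∷ []) (allSubsets k)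

independentS : (G : Graph) → Subset (n G) → Bool
independentS G S = all (λ u → all (λ v → not (∈S S u ∧ ∈S S v ∧ adj G u v)) (allFin (n G))) (allFin (n G))

nonemptyS : {k : ℕ} → Subset k → Bool
nonemptyS {k} S = any (∈S S) (allFin k)

sizeS : {k : ℕ} → Subset k → ℕ
sizeS {k} S = count (∈S S) (allFin k)

sizeN : (G : Graph) → Subset (n G) → ℕ
sizeN G S = count (λ v → any (λ u → ∈S S u ∧ adj G u v) (allFin (n G))) (allFin (n G))

aG : Graph → ℚ
aG G = maxℚ (map (λ S → ratio (sizeS S) (sizeS S + sizeN G S))
                 (filter (λ S → Data.Bool._≟_ (independentS G S ∧ nonemptyS S) true) (allSubsets (n G))))

a* : Graph → ℚ
a* G = if ⌊ Data.Rational._≤?_ (aG G) Data.Rational.½ ⌋ then aG G else Data.Rational.1ℚ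

-- Fractional matchings. Edges are represented as pairs (u , v) with
-- toℕ u < toℕ v and adj u v = true; f is given as a function on all
-- ordered pairs of which only the values on these edge representatives
-- are used (so f is exactly a function E(G) → ℚ).

edges : (G : Graph) → List (Fin (n G) × Fin (n G))
edges G = concatMap (λ u → map (λ v → u , v)
            (filter (λ v → Data.Bool._≟_ (⌊ toℕ u <? toℕ v ⌋ ∧ adj G u v) true) (allFin (n G))))
            (allFin (n G))

edgeWeight : (G : Graph) → (Fin (n G) → Fin (n G) → ℚ) → Fin (n G) × Fin (n G) → ℚ
edgeWeight G f e = f (proj₁ e) (proj₂ e)

incident : (G : Graph) → Fin (n G) → List (Fin (n G) × Fin (n G))
incident G w = filter (λ e → Data.Bool._≟_ (⌊ proj₁ e Data.Fin.≟ w ⌋ ∨ ⌊ proj₂ e Data.Fin.≟ w ⌋) true) (edges G)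

record FractionalMatching (G : Graph) : Set where
  field
    f       : Fin (n G) → Fin (n G) → ℚ
    nonneg  : ∀ e → e ∈ edges G → 0ℚ Data.Rational.≤ edgeWeight G f e
    vertex≤ : ∀ w → sumℚ (map (edgeWeight G f) (incident G w)) Data.Rational.≤ Data.Rational.1ℚ

IsPerfect : (G : Graph) → FractionalMatching G → Set
IsPerfect G M = sumℚ (map (edgeWeight G (FractionalMatching.f M)) (edges G)) ≡ ratio (n G) 2

HasFractionalPerfectMatching : Graph → Set
HasFractionalPerfectMatching G = Σ (FractionalMatching G) (IsPerfect G)

{-# OPTIONS --safe #-}

-- Hall's theorem for the bipartite double cover of G yields a dichotomy: either
-- the double cover has a perfect matching M, or some independent I has |N(I)| < |I|.
--
-- In the first case (M + Mᵀ)/2 is a fractional perfect matching, |N(S)| ≥ |S| for all S (so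
-- a(G) ≤ ½), and applying M coordinatewise gives the same expansion in every G^m, so i(G^m) ≤ ½.
--
-- In the second case a(G) > ½, the weights 1 - [I] + [N(I)] form a fractional vertex cover (up
-- to the factor 2) too light for a fractional perfect matching to exist, and the vertices of G^m
-- with more coordinates in I than in N(I) form an independent set: along an edge xy, the
-- coordinates of x in I lie over coordinates of y in N(I). By the law of large numbers (here an
-- exponential moment bound) this set has density tending to 1.
module Submission where

open import Defs hiding (sym)
open import Algebra.Structures using (IsCommutativeRing; IsCommutativeSemiring)
open import Data.Bool using (Bool; true; false; _∧_; _∨_; not; if_then_else_)
import Data.Bool as Bool
open import Data.Bool.ListAction using (any; all)
open import Data.Bool.Properties using (T-≡; ∨-zeroʳ; ∧-identityʳ; ∨-comm)
open import Data.Fin as Fin using (Fin; toℕ)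
open import Data.Fin.Properties using (any?; toℕ-injective)
open import Data.Fin.Subset using (Subset)
open import Data.Fin.Subset.Properties using (anySubset?)
open import Data.Integer as ℤ using (+<+; +≤+)
import Data.Integer.Properties as ℤₚ
open import Data.List using (List; []; _∷_; _++_; map; concatMap; foldr; filter; allFin; length)
open import Data.List.Membership.Propositional using (_∈_; find; lose)
open import Data.List.Membership.Propositional.Properties
  using (∈-allFin; ∈-map⁺; ∈-map⁻; ∈-filter⁺; ∈-filter⁻; ∈-concatMap⁺; ∈-concatMap⁻)
open import Data.List.Properties using (map-tabulate)
import Data.List.Relation.Unary.All as All
open import Data.List.Relation.Unary.All.Properties using (all⁺; all⁻)
open import Data.List.Relation.Unary.Any using (here; there)
open import Data.List.Relation.Unary.Any.Properties using (any⁺; any⁻)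
open import Data.Nat as ℕ using (ℕ; zero; suc; _+_; _*_; _∸_; _^_; _≤_; _<_; z≤n; s≤s)
open import Data.Nat.Properties as ℕₚ using (module ≤-Reasoning; _<?_)
open import Data.Nat.Tactic.RingSolver using (solve-∀)
open import Data.Product using (∃; _×_; _,_; proj₁; proj₂)
open import Data.Rational as ℚ using (ℚ; mkℚ; 0ℚ; 1ℚ; ½; toℚᵘ)
import Data.Rational.Properties as ℚₚ
open import Data.Rational.Unnormalised as ℚᵘ using (mkℚᵘ; *≡*; *≤*; *<*; _≃_)
import Data.Rational.Unnormalised.Properties as ℚᵘₚ
open import Data.Sum using (_⊎_; inj₁; inj₂)
open import Data.Vec as Vec using (Vec; []; _∷_; lookup)
open import Data.Vec.Properties using (lookup∘tabulate)
open import Function using (_∘_; id)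
open import Function.Bundles using (Equivalence; _⇔_; mk⇔)
open import Relation.Binary.PropositionalEquality
open import Relation.Nullary using (¬_; Dec; yes; no; contradiction)
open import Relation.Nullary.Decidable using (⌊_⌋; ¬?; _×-dec_)
open import Algebra.Properties.Group ℚₚ.+-0-group using (⁻¹-involutive)

-- No implication among the three conditions is proved by itself: the dichotomy is decided by a
-- finite search, and each alternative settles all three conditions at once. This keeps the argument
-- constructive although (iii) is a negation.
--
-- The double cover is needed because a graph with a fractional perfect matching may have no perfect
-- matching, as an odd cycle shows. A perfect matching of the double cover is only a permutation
-- moving each vertex to a neighbour: its 2-cycles become edges of weight 1, its longer cycles
-- consist of edges of weight ½.
--
-- For the limit a crude rate suffices. The exceptional density is bounded by W/(W+m), for a
-- constant W depending on the graph only, so no logarithms or real exponentials occur. All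
-- estimates are cleared of denominators and carried out in ℕ; rationals enter only when the bounds
-- are compared with `ratio`.

private variable
  X Y : Set

_==_ : ∀ {n} → Fin n → Fin n → Bool
u == v = ⌊ u Fin.≟ v ⌋

-- Finite sums over lists, for use in ℕ and in ℚ.

module ListSum {A : Set} (_⊕_ _⊗_ : A → A → A) (0# 1# : A)
  (isCommutativeSemiring : IsCommutativeSemiring _≡_ _⊕_ _⊗_ 0# 1#)
  (_⊑_ : A → A → Set) (⊑-refl : ∀ {x} → x ⊑ x)
  (⊕-mono : ∀ {x y u v} → x ⊑ y → u ⊑ v → (x ⊕ u) ⊑ (y ⊕ v)) where

  open IsCommutativeSemiring isCommutativeSemiring
    using (+-assoc; +-comm; +-identityˡ; +-identityʳ; *-identityˡ; zeroˡ; zeroʳ; distribˡ)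
  open ≡-Reasoning

  -- Unfolds to the same `foldr` over `map` as `sumℚ (map f xs)`, so the sums in the definition of a
  -- fractional matching are instances by definition.
  ∑ : List X → (X → A) → A
  ∑ xs f = foldr _⊕_ 0# (map f xs)

  ⟦_⟧ : Bool → A
  ⟦ b ⟧ = if b then 1# else 0#

  ∑-cong∈ : (xs : List X) {f g : X → A} → (∀ x → x ∈ xs → f x ≡ g x) → ∑ xs f ≡ ∑ xs g
  ∑-cong∈ []       h = refl
  ∑-cong∈ (x ∷ xs) h = cong₂ _⊕_ (h x (here refl)) (∑-cong∈ xs (λ y → h y ∘ there))

  ∑-cong : (xs : List X) {f g : X → A} → (∀ x → f x ≡ g x) → ∑ xs f ≡ ∑ xs g
  ∑-cong xs h = ∑-cong∈ xs (λ x _ → h x)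

  ∑-mono∈ : (xs : List X) {f g : X → A} → (∀ x → x ∈ xs → f x ⊑ g x) → ∑ xs f ⊑ ∑ xs g
  ∑-mono∈ []       h = ⊑-refl
  ∑-mono∈ (x ∷ xs) h = ⊕-mono (h x (here refl)) (∑-mono∈ xs (λ y → h y ∘ there))

  ∑-mono : (xs : List X) {f g : X → A} → (∀ x → f x ⊑ g x) → ∑ xs f ⊑ ∑ xs g
  ∑-mono xs h = ∑-mono∈ xs (λ x _ → h x)

  ∑-zero : (xs : List X) → ∑ xs (λ _ → 0#) ≡ 0#
  ∑-zero []       = refl
  ∑-zero (x ∷ xs) = trans (+-identityˡ _) (∑-zero xs)

  interchange : ∀ a b c d → (a ⊕ b) ⊕ (c ⊕ d) ≡ (a ⊕ c) ⊕ (b ⊕ d)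
  interchange a b c d = begin
    (a ⊕ b) ⊕ (c ⊕ d)  ≡⟨ +-assoc a b (c ⊕ d) ⟩
    a ⊕ (b ⊕ (c ⊕ d))  ≡⟨ cong (a ⊕_) (sym (+-assoc b c d)) ⟩
    a ⊕ ((b ⊕ c) ⊕ d)  ≡⟨ cong (λ z → a ⊕ (z ⊕ d)) (+-comm b c) ⟩
    a ⊕ ((c ⊕ b) ⊕ d)  ≡⟨ cong (a ⊕_) (+-assoc c b d) ⟩
    a ⊕ (c ⊕ (b ⊕ d))  ≡⟨ sym (+-assoc a c (b ⊕ d)) ⟩
    (a ⊕ c) ⊕ (b ⊕ d)  ∎

  ∑-distrib-⊕ : (xs : List X) (f g : X → A) → ∑ xs (λ x → f x ⊕ g x) ≡ ∑ xs f ⊕ ∑ xs g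
  ∑-distrib-⊕ []       f g = sym (+-identityˡ 0#)
  ∑-distrib-⊕ (x ∷ xs) f g =
    trans (cong ((f x ⊕ g x) ⊕_) (∑-distrib-⊕ xs f g)) (interchange (f x) (g x) (∑ xs f) (∑ xs g))

  ∑-*ˡ : (xs : List X) (c : A) (f : X → A) → ∑ xs (λ x → c ⊗ f x) ≡ c ⊗ ∑ xs f
  ∑-*ˡ []       c f = sym (zeroʳ c)
  ∑-*ˡ (x ∷ xs) c f =
    trans (cong ((c ⊗ f x) ⊕_) (∑-*ˡ xs c f)) (sym (distribˡ c (f x) (∑ xs f)))

  ∑-swap : (xs : List X) (ys : List Y) (f : X → Y → A) →
           ∑ xs (λ x → ∑ ys (f x)) ≡ ∑ ys (λ y → ∑ xs (λ x → f x y))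
  ∑-swap []       ys f = sym (∑-zero ys)
  ∑-swap (x ∷ xs) ys f =
    trans (cong (∑ ys (f x) ⊕_) (∑-swap xs ys f))
          (sym (∑-distrib-⊕ ys (f x) (λ y → ∑ xs (λ x′ → f x′ y))))

  ∑-filter : (p : X → Bool) (xs : List X) (f : X → A) →
             ∑ (filter (λ x → p x Bool.≟ true) xs) f ≡ ∑ xs (λ x → ⟦ p x ⟧ ⊗ f x)
  ∑-filter p []       f = refl
  ∑-filter p (x ∷ xs) f with p x
  ... | true  = cong₂ _⊕_ (sym (*-identityˡ (f x))) (∑-filter p xs f)
  ... | false = begin
    ∑ (filter (λ y → p y Bool.≟ true) xs) f             ≡⟨ ∑-filter p xs f ⟩
    ∑ xs (λ y → ⟦ p y ⟧ ⊗ f y)                          ≡⟨ sym (+-identityˡ _) ⟩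
    0# ⊕ ∑ xs (λ y → ⟦ p y ⟧ ⊗ f y)
      ≡⟨ cong (_⊕ ∑ xs (λ y → ⟦ p y ⟧ ⊗ f y)) (sym (zeroˡ (f x))) ⟩
    (0# ⊗ f x) ⊕ ∑ xs (λ y → ⟦ p y ⟧ ⊗ f y)             ∎

  ∑-map : (h : X → Y) (xs : List X) (f : Y → A) → ∑ (map h xs) f ≡ ∑ xs (f ∘ h)
  ∑-map h []       f = refl
  ∑-map h (x ∷ xs) f = cong (f (h x) ⊕_) (∑-map h xs f)

  ∑-++ : (xs ys : List X) (f : X → A) → ∑ (xs ++ ys) f ≡ ∑ xs f ⊕ ∑ ys f
  ∑-++ []       ys f = sym (+-identityˡ _)
  ∑-++ (x ∷ xs) ys f = trans (cong (f x ⊕_) (∑-++ xs ys f)) (sym (+-assoc (f x) (∑ xs f) (∑ ys f)))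

  ∑-concatMap : (h : X → List Y) (xs : List X) (f : Y → A) →
                ∑ (concatMap h xs) f ≡ ∑ xs (λ x → ∑ (h x) f)
  ∑-concatMap h []       f = refl
  ∑-concatMap h (x ∷ xs) f =
    trans (∑-++ (h x) (concatMap h xs) f) (cong (∑ (h x) f ⊕_) (∑-concatMap h xs f))

  ∑-allFin-suc : ∀ n (f : Fin (suc n) → A) →
                 ∑ (allFin (suc n)) f ≡ f Fin.zero ⊕ ∑ (allFin n) (f ∘ Fin.suc)
  ∑-allFin-suc n f = cong (f Fin.zero ⊕_)
    (trans (cong (λ l → ∑ l f) (sym (map-tabulate id Fin.suc))) (∑-map Fin.suc (allFin n) f))

  ∑-== : ∀ n (w : Fin n) (f : Fin n → A) → ∑ (allFin n) (λ v → ⟦ v == w ⟧ ⊗ f v) ≡ f w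
  ∑-== (suc n) Fin.zero f = begin
    ∑ (allFin (suc n)) (λ v → ⟦ v == Fin.zero ⟧ ⊗ f v)
      ≡⟨ ∑-allFin-suc n (λ v → ⟦ v == Fin.zero ⟧ ⊗ f v) ⟩
    (1# ⊗ f Fin.zero) ⊕ ∑ (allFin n) (λ v → 0# ⊗ f (Fin.suc v))
      ≡⟨ cong₂ _⊕_ (*-identityˡ _)
           (trans (∑-cong (allFin n) (λ v → zeroˡ (f (Fin.suc v)))) (∑-zero (allFin n))) ⟩
    f Fin.zero ⊕ 0#
      ≡⟨ +-identityʳ _ ⟩
    f Fin.zero ∎
  ∑-== (suc n) (Fin.suc w) f = begin
    ∑ (allFin (suc n)) (λ v → ⟦ v == Fin.suc w ⟧ ⊗ f v)
      ≡⟨ ∑-allFin-suc n (λ v → ⟦ v == Fin.suc w ⟧ ⊗ f v) ⟩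
    (0# ⊗ f Fin.zero) ⊕ ∑ (allFin n) (λ v → ⟦ Fin.suc v == Fin.suc w ⟧ ⊗ f (Fin.suc v))
      ≡⟨ cong₂ _⊕_ (zeroˡ _)
           (∑-cong (allFin n) (λ v → cong (λ b → ⟦ b ⟧ ⊗ f (Fin.suc v)) (suc-== v))) ⟩
    0# ⊕ ∑ (allFin n) (λ v → ⟦ v == w ⟧ ⊗ f (Fin.suc v))
      ≡⟨ trans (+-identityˡ _) (∑-== n w (f ∘ Fin.suc)) ⟩
    f (Fin.suc w) ∎
    where
    suc-== : ∀ v → (Fin.suc v == Fin.suc w) ≡ (v == w)
    suc-== v with v Fin.≟ w
    ... | yes _ = refl
    ... | no  _ = refl

open ListSum _+_ _*_ 0 1 ℕₚ.+-*-isCommutativeSemiring _≤_ ℕₚ.≤-refl ℕₚ.+-mono-≤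

-- Boolean predicates and their cardinalities.

true⇒T : ∀ {b} → b ≡ true → Bool.T b
true⇒T = Equivalence.from T-≡

T⇒true : ∀ {b} → Bool.T b → b ≡ true
T⇒true = Equivalence.to T-≡

any-intro : (p : X → Bool) {xs : List X} {x : X} → x ∈ xs → p x ≡ true → any p xs ≡ true
any-intro p x∈xs px = T⇒true (any⁺ p (lose x∈xs (true⇒T px)))

any-elim : (p : X → Bool) (xs : List X) → any p xs ≡ true → ∃ λ x → x ∈ xs × p x ≡ true
any-elim p xs h with find (any⁻ p xs (true⇒T h))
... | x , x∈xs , px = x , x∈xs , T⇒true px

all-intro : (p : X → Bool) (xs : List X) → (∀ x → x ∈ xs → p x ≡ true) → all p xs ≡ true
all-intro p xs h = T⇒true (all⁻ p (All.tabulate (λ {x} x∈xs → true⇒T (h x x∈xs))))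

all-elim : (p : X → Bool) {xs : List X} {x : X} → all p xs ≡ true → x ∈ xs → p x ≡ true
all-elim p {xs} h x∈xs = T⇒true (All.lookup (all⁺ p xs (true⇒T h)) x∈xs)

∧-intro : ∀ {a b} → a ≡ true → b ≡ true → a ∧ b ≡ true
∧-intro refl refl = refl

∧-elim : ∀ {a b} → a ∧ b ≡ true → a ≡ true × b ≡ true
∧-elim {true} h = refl , h

∨-introˡ : ∀ {a b} → a ≡ true → a ∨ b ≡ true
∨-introˡ refl = refl

∨-introʳ : ∀ a {b} → b ≡ true → a ∨ b ≡ true
∨-introʳ a refl = ∨-zeroʳ a

∨-elim : ∀ {a b} → a ∨ b ≡ true → a ≡ true ⊎ b ≡ true
∨-elim {true}  h = inj₁ refl
∨-elim {false} h = inj₂ h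

not-elim : ∀ {a} → not a ≡ true → a ≡ false
not-elim {false} h = refl

true≢false : ∀ {a} {Z : Set} → a ≡ true → a ≡ false → Z
true≢false refl ()

==-refl : ∀ {n} (u : Fin n) → (u == u) ≡ true
==-refl u with u Fin.≟ u
... | yes _  = refl
... | no u≢u = contradiction refl u≢u

==⇒≡ : ∀ {n} {u v : Fin n} → (u == v) ≡ true → u ≡ v
==⇒≡ {u = u} {v} h with u Fin.≟ v
... | yes u≡v = u≡v
==⇒≡ () | no _

≢⇒== : ∀ {n} {u v : Fin n} → u ≢ v → (u == v) ≡ false
≢⇒== {u = u} {v} u≢v with u Fin.≟ v
... | yes u≡v = contradiction u≡v u≢v
... | no _    = refl

⟦⟧-mono : ∀ {a b} → (a ≡ true → b ≡ true) → ⟦ a ⟧ ≤ ⟦ b ⟧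
⟦⟧-mono {false} h = z≤n
⟦⟧-mono {true}  h rewrite h refl = ℕₚ.≤-refl

⟦⟧-complement : ∀ b → ⟦ b ⟧ + ⟦ not b ⟧ ≡ 1
⟦⟧-complement false = refl
⟦⟧-complement true  = refl

⟦⟧-∨-∧ : ∀ c d → ⟦ c ∨ d ⟧ + ⟦ c ∧ d ⟧ ≡ ⟦ c ⟧ + ⟦ d ⟧
⟦⟧-∨-∧ false d     = ℕₚ.+-identityʳ ⟦ d ⟧
⟦⟧-∨-∧ true  false = refl
⟦⟧-∨-∧ true  true  = refl

count≡∑ : (p : X → Bool) (xs : List X) → count p xs ≡ ∑ xs (⟦_⟧ ∘ p)
count≡∑ p []       = refl
count≡∑ p (x ∷ xs) with p x
... | true  = cong suc (count≡∑ p xs)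
... | false = count≡∑ p xs

card : ∀ {n} → (Fin n → Bool) → ℕ
card {n} p = ∑ (allFin n) (⟦_⟧ ∘ p)

card-cong : ∀ {n} {p q : Fin n → Bool} → (∀ v → p v ≡ q v) → card p ≡ card q
card-cong {n} h = ∑-cong (allFin n) (cong ⟦_⟧ ∘ h)

card-mono : ∀ {n} {p q : Fin n → Bool} → (∀ v → p v ≡ true → q v ≡ true) → card p ≤ card q
card-mono {n} h = ∑-mono (allFin n) (λ v → ⟦⟧-mono (h v))

card-witness : ∀ {n} (p : Fin n → Bool) → 1 ≤ card p → ∃ λ v → p v ≡ true
card-witness {n} p 1≤card with any? (λ v → p v Bool.≟ true)
... | yes w    = w
... | no  none = contradiction
  (ℕₚ.≤-trans 1≤card (ℕₚ.≤-trans (card-mono (λ v pv → contradiction (v , pv) none))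
                                 (ℕₚ.≤-reflexive (∑-zero (allFin n)))))
  λ ()

card-singleton : ∀ {n} (w : Fin n) → card (_== w) ≡ 1
card-singleton {n} w = trans (∑-cong (allFin n) (λ v → sym (ℕₚ.*-identityʳ ⟦ v == w ⟧))) (∑-== n w (λ _ → 1))

∑-1 : ∀ n → ∑ (allFin n) (λ _ → 1) ≡ n
∑-1 zero    = refl
∑-1 (suc n) = trans (∑-allFin-suc n (λ _ → 1)) (cong suc (∑-1 n))

-- Hall's theorem for bipartite graphs on two copies of `Fin n`.

-- The matrix of a bipartite graph between two copies of `Fin n`: `adj G` is the double cover.
-- Symmetry is not imposed, since deleting an edge of the cover destroys it.
Rel : ℕ → Set
Rel n = Fin n → Fin n → Bool

-- For `R = adj G` this is literally the test counted by `sizeN`, so `count≡∑` applies without any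
-- conversion.
nbhd : ∀ {n} → Rel n → (Fin n → Bool) → Fin n → Bool
nbhd {n} R S v = any (λ u → S u ∧ R u v) (allFin n)

module _ {n} (R : Rel n) (S : Fin n → Bool) where

  nbhd-intro : ∀ {u v} → S u ≡ true → R u v ≡ true → nbhd R S v ≡ true
  nbhd-intro {u} {v} Su Ruv = any-intro (λ u → S u ∧ R u v) (∈-allFin u) (∧-intro Su Ruv)

  nbhd-elim : ∀ {v} → nbhd R S v ≡ true → ∃ λ u → S u ≡ true × R u v ≡ true
  nbhd-elim {v} h with any-elim (λ u → S u ∧ R u v) (allFin n) h
  ... | u , _ , h′ = u , ∧-elim h′

nbhd-cong : ∀ {n} (R : Rel n) {S S′ : Fin n → Bool} → (∀ u → S u ≡ S′ u) → ∀ v → nbhd R S v ≡ nbhd R S′ v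
nbhd-cong {n} R {S} {S′} h v with nbhd R S v in eq | nbhd R S′ v in eq′
... | true  | true  = refl
... | false | false = refl
... | true  | false with nbhd-elim R S eq
...   | u , Su , Ruv = true≢false (nbhd-intro R S′ (trans (sym (h u)) Su) Ruv) eq′
nbhd-cong {n} R {S} {S′} h v | false | true with nbhd-elim R S′ eq′
...   | u , Su , Ruv = true≢false (nbhd-intro R S (trans (h u) Su) Ruv) eq

HallCondition : ∀ {n} → Rel n → Set
HallCondition {n} R = (S : Fin n → Bool) → card S ≤ card (nbhd R S)

-- The search runs over vectors, of which there are finitely many. Functions are compared with their
-- tabulations only pointwise, which is why `card` and `nbhd` need congruence lemmas.
Hall? : ∀ {n} (R : Rel n) → HallCondition R ⊎ ∃ λ S → card (nbhd R S) < card S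
Hall? R with anySubset? (λ s → card (nbhd R (lookup s)) ℕ.<? card (lookup s))
... | yes (s , lt) = inj₂ (lookup s , lt)
... | no none      = inj₁ λ S → subst₂ _≤_ (card-cong (lookup∘tabulate S))
        (card-cong (nbhd-cong R (lookup∘tabulate S)))
        (ℕₚ.≮⇒≥ (λ lt → none (Vec.tabulate S , lt)))

deleteEdge : ∀ {n} → Rel n → Fin n → Fin n → Rel n
deleteEdge R x y u v = R u v ∧ not ((u == x) ∧ (v == y))

deleteEdge-intro : ∀ {n} (R : Rel n) {x y u v} → R u v ≡ true → ¬ (u ≡ x × v ≡ y) → deleteEdge R x y u v ≡ true
deleteEdge-intro R {x} {y} {u} {v} Ruv h with u Fin.≟ x | v Fin.≟ y
... | yes p | yes q = contradiction (p , q) h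
... | yes _ | no  _ = ∧-intro Ruv refl
... | no  _ | _     = ∧-intro Ruv refl

-- The sets S₁, S₂ violating Hall's condition after deleting xy₁, resp. xy₂, both contain x, and
-- the submodularity of |N(·)|, applied to S₁ ∪ S₂ and (S₁ ∩ S₂) \ {x}, yields a violation in R.
delete-one-of-two : ∀ {n} (R : Rel n) {x y₁ y₂} → y₁ ≢ y₂ → HallCondition R →
  HallCondition (deleteEdge R x y₁) ⊎ HallCondition (deleteEdge R x y₂)
delete-one-of-two {n} R {x} {y₁} {y₂} y₁≢y₂ hall with Hall? (deleteEdge R x y₁) | Hall? (deleteEdge R x y₂)
... | inj₁ h | _      = inj₁ h
... | inj₂ _ | inj₁ h = inj₂ h
... | inj₂ (S₁ , lt₁) | inj₂ (S₂ , lt₂) = contradiction contra ℕₚ.1+n≰n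
  where
  R₁ = deleteEdge R x y₁
  R₂ = deleteEdge R x y₂

  -- A set without `x` keeps its whole neighbourhood when an edge at `x` is deleted, so it cannot
  -- begin to violate Hall's condition.
  x∈ : ∀ {y} S → card (nbhd (deleteEdge R x y) S) < card S → S x ≡ true
  x∈ {y} S lt with S x in Sx
  ... | true  = refl
  ... | false = contradiction (ℕₚ.≤-<-trans (ℕₚ.≤-trans (hall S) (card-mono sub)) lt) (ℕₚ.<-irrefl refl)
    where
    sub : ∀ v → nbhd R S v ≡ true → nbhd (deleteEdge R x y) S v ≡ true
    sub v h with nbhd-elim R S h
    ... | u , Su , Ruv = nbhd-intro (deleteEdge R x y) S Su
          (deleteEdge-intro R Ruv λ { (refl , _) → true≢false Su Sx })

  S∪ S∩ : Fin n → Bool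
  S∪ u = S₁ u ∨ S₂ u
  -- `x` must be dropped: its edge to `y₁` is absent from `R₁`, so `N₁` need not contain `y₁`.
  S∩ u = (S₁ u ∧ S₂ u) ∧ not (u == x)

  N₁ = nbhd R₁ S₁
  N₂ = nbhd R₂ S₂

  N∪⊆ : ∀ v → nbhd R S∪ v ≡ true → N₁ v ∨ N₂ v ≡ true
  N∪⊆ v h with nbhd-elim R S∪ h
  ... | u , Su , Ruv = split (u Fin.≟ x) (v Fin.≟ y₁) (∨-elim Su)
    where
    in₁ : S₁ u ≡ true → ¬ (u ≡ x × v ≡ y₁) → N₁ v ∨ N₂ v ≡ true
    in₁ S₁u kept = ∨-introˡ (nbhd-intro R₁ S₁ S₁u (deleteEdge-intro R Ruv kept))

    in₂ : S₂ u ≡ true → ¬ (u ≡ x × v ≡ y₂) → N₁ v ∨ N₂ v ≡ true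
    in₂ S₂u kept = ∨-introʳ (N₁ v) (nbhd-intro R₂ S₂ S₂u (deleteEdge-intro R Ruv kept))

    -- Both sets contain `x`, so the edge `x y₁` lost in `R₁` is recovered from `S₂` in `R₂`; every
    -- other edge at `x` survives in `R₁`.
    split : Dec (u ≡ x) → Dec (v ≡ y₁) → S₁ u ≡ true ⊎ S₂ u ≡ true → N₁ v ∨ N₂ v ≡ true
    split (yes u≡x) (yes v≡y₁) _ =
      in₂ (trans (cong S₂ u≡x) (x∈ S₂ lt₂)) (λ (_ , v≡y₂) → y₁≢y₂ (trans (sym v≡y₁) v≡y₂))
    split (yes u≡x) (no v≢y₁) _          = in₁ (trans (cong S₁ u≡x) (x∈ S₁ lt₁)) (v≢y₁ ∘ proj₂)
    split (no u≢x)  _         (inj₁ S₁u) = in₁ S₁u (u≢x ∘ proj₁)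
    split (no u≢x)  _         (inj₂ S₂u) = in₂ S₂u (u≢x ∘ proj₁)

  N∩⊆ : ∀ v → nbhd R S∩ v ≡ true → N₁ v ∧ N₂ v ≡ true
  N∩⊆ v h with nbhd-elim R S∩ h
  ... | u , Su , Ruv with ∧-elim Su
  ... | S₁₂u , u≢x with ∧-elim S₁₂u
  ... | S₁u , S₂u = ∧-intro (nbhd-intro R₁ S₁ S₁u (keep y₁)) (nbhd-intro R₂ S₂ S₂u (keep y₂))
    where
    keep : ∀ y → deleteEdge R x y u v ≡ true
    keep y = deleteEdge-intro R Ruv λ { (refl , _) → true≢false (==-refl u) (not-elim u≢x) }

  submodular : card (nbhd R S∪) + card (nbhd R S∩) ≤ card N₁ + card N₂
  submodular = begin
    card (nbhd R S∪) + card (nbhd R S∩)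
      ≡⟨ ∑-distrib-⊕ (allFin n) _ _ ⟨
    ∑ (allFin n) (λ v → ⟦ nbhd R S∪ v ⟧ + ⟦ nbhd R S∩ v ⟧)
      ≤⟨ ∑-mono (allFin n) (λ v → ℕₚ.≤-trans
           (ℕₚ.+-mono-≤ (⟦⟧-mono (N∪⊆ v)) (⟦⟧-mono (N∩⊆ v)))
           (ℕₚ.≤-reflexive (⟦⟧-∨-∧ (N₁ v) (N₂ v)))) ⟩
    ∑ (allFin n) (λ v → ⟦ N₁ v ⟧ + ⟦ N₂ v ⟧)
      ≡⟨ ∑-distrib-⊕ (allFin n) _ _ ⟩
    card N₁ + card N₂ ∎
    where open ≤-Reasoning

  modular : card S₁ + card S₂ ≤ card S∪ + card S∩ + 1
  modular = begin
    card S₁ + card S₂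
      ≡⟨ ∑-distrib-⊕ (allFin n) _ _ ⟨
    ∑ (allFin n) (λ u → ⟦ S₁ u ⟧ + ⟦ S₂ u ⟧)
      ≤⟨ ∑-mono (allFin n) (λ u → bound (S₁ u) (S₂ u) (u == x)) ⟩
    ∑ (allFin n) (λ u → ⟦ S∪ u ⟧ + ⟦ S∩ u ⟧ + ⟦ u == x ⟧)
      ≡⟨ trans (∑-distrib-⊕ (allFin n) _ _) (cong₂ _+_ (∑-distrib-⊕ (allFin n) _ _) (card-singleton x)) ⟩
    card S∪ + card S∩ + 1 ∎
    where
    open ≤-Reasoning
    bound : ∀ a b c → ⟦ a ⟧ + ⟦ b ⟧ ≤ ⟦ a ∨ b ⟧ + ⟦ (a ∧ b) ∧ not c ⟧ + ⟦ c ⟧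
    bound true  true  true  = ℕₚ.≤-refl
    bound true  true  false = ℕₚ.≤-refl
    bound true  false c     = s≤s z≤n
    bound false true  c     = s≤s z≤n
    bound false false c     = z≤n

  -- The two strict violations gain 2 and dropping `x` costs 1, which leaves a contradiction by 1.
  contra : suc (card S₁ + card S₂) ≤ card S₁ + card S₂
  contra = begin
    suc (card S₁ + card S₂)                        ≤⟨ s≤s modular ⟩
    suc (card S∪ + card S∩ + 1)                    ≤⟨ s≤s (ℕₚ.+-monoˡ-≤ 1 (ℕₚ.+-mono-≤ (hall S∪) (hall S∩))) ⟩
    suc (card (nbhd R S∪) + card (nbhd R S∩) + 1)  ≤⟨ s≤s (ℕₚ.+-monoˡ-≤ 1 submodular) ⟩
    suc (card N₁ + card N₂ + 1)                    ≡⟨ cong suc (ℕₚ.+-comm _ 1) ⟩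
    suc (suc (card N₁ + card N₂))                  ≡⟨ cong suc (ℕₚ.+-suc (card N₁) (card N₂)) ⟨
    suc (card N₁) + suc (card N₂)                  ≤⟨ ℕₚ.+-mono-≤ lt₁ lt₂ ⟩
    card S₁ + card S₂                              ∎
    where open ≤-Reasoning

size : ∀ {n} → Rel n → ℕ
size {n} R = ∑ (allFin n) (λ u → card (R u))

size-deleteEdge : ∀ {n} (R : Rel n) {x y} → R x y ≡ true → size R ≡ suc (size (deleteEdge R x y))
size-deleteEdge {n} R {x} {y} Rxy = begin
  size R
    ≡⟨ ∑-cong (allFin n) (λ u → ∑-cong (allFin n) (split u)) ⟩
  ∑ (allFin n) (λ u → ∑ (allFin n) (λ v → ⟦ u == x ⟧ * ⟦ v == y ⟧ + ⟦ deleteEdge R x y u v ⟧))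
    ≡⟨ ∑-cong (allFin n) (λ u → trans (∑-distrib-⊕ (allFin n) _ _)
         (cong (_+ card (deleteEdge R x y u)) (∑-*ˡ (allFin n) ⟦ u == x ⟧ (λ v → ⟦ v == y ⟧)))) ⟩
  ∑ (allFin n) (λ u → ⟦ u == x ⟧ * card (_== y) + card (deleteEdge R x y u))
    ≡⟨ ∑-distrib-⊕ (allFin n) _ _ ⟩
  ∑ (allFin n) (λ u → ⟦ u == x ⟧ * card (_== y)) + size (deleteEdge R x y)
    ≡⟨ cong (_+ size (deleteEdge R x y)) (trans (∑-== n x (λ _ → card (_== y))) (card-singleton y)) ⟩
  suc (size (deleteEdge R x y)) ∎
  where
  open ≡-Reasoning
  split : ∀ u v → ⟦ R u v ⟧ ≡ ⟦ u == x ⟧ * ⟦ v == y ⟧ + ⟦ deleteEdge R x y u v ⟧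
  split u v with u Fin.≟ x | v Fin.≟ y
  ... | yes refl | yes refl rewrite Rxy = refl
  ... | yes _    | no _     = cong ⟦_⟧ (sym (∧-identityʳ (R u v)))
  ... | no _     | _        = cong ⟦_⟧ (sym (∧-identityʳ (R u v)))

-- A perfect matching of the bipartite double cover, as a 0/1 matrix.
record Matching {n} (R : Rel n) : Set where
  field
    M      : Rel n
    M⊆R    : ∀ u v → M u v ≡ true → R u v ≡ true
    row≡1  : ∀ u → card (M u) ≡ 1
    col≤1  : ∀ v → card (λ u → M u v) ≤ 1

-- Hall's condition for a singleton gives every row an entry. The rows with an entry in column `v`
-- have no neighbour but `v`, so Hall's condition allows at most one of them.
functional⇒matching : ∀ {n} (R : Rel n) → HallCondition R →
  (∀ x y₁ y₂ → R x y₁ ≡ true → R x y₂ ≡ true → y₁ ≡ y₂) → Matching R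
functional⇒matching {n} R hall unique = record
  { M = R ; M⊆R = λ _ _ h → h ; row≡1 = λ u → ℕₚ.≤-antisym (row≤1 u) (1≤row u) ; col≤1 = col≤1 }
  where
  open ≤-Reasoning
  1≤row : ∀ u → 1 ≤ card (R u)
  1≤row u = begin
    1                     ≡⟨ card-singleton u ⟨
    card (_== u)          ≤⟨ hall (_== u) ⟩
    card (nbhd R (_== u)) ≤⟨ card-mono sub ⟩
    card (R u)            ∎
    where
    sub : ∀ v → nbhd R (_== u) v ≡ true → R u v ≡ true
    sub v h with nbhd-elim R (_== u) h
    ... | u′ , u′≡u , Ru′v = subst (λ w → R w v ≡ true) (==⇒≡ u′≡u) Ru′v

  row≤1 : ∀ u → card (R u) ≤ 1
  row≤1 u with card-witness (R u) (1≤row u)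
  ... | w , Ruw = begin
    card (R u)    ≤⟨ card-mono (λ v Ruv → trans (cong (_== w) (unique u v w Ruv Ruw)) (==-refl w)) ⟩
    card (_== w)  ≡⟨ card-singleton w ⟩
    1             ∎

  col≤1 : ∀ v → card (λ u → R u v) ≤ 1
  col≤1 v = begin
    card (λ u → R u v)           ≤⟨ hall (λ u → R u v) ⟩
    card (nbhd R (λ u → R u v))  ≤⟨ card-mono sub ⟩
    card (_== v)                 ≡⟨ card-singleton v ⟩
    1                            ∎
    where
    sub : ∀ w → nbhd R (λ u → R u v) w ≡ true → (w == v) ≡ true
    sub w h with nbhd-elim R (λ u → R u v) h
    ... | u , Ruv , Ruw = trans (cong (_== v) (unique u w v Ruw Ruv)) (==-refl v)

-- Rado's proof: delete edges while Hall's condition persists.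
hall⇒matching : ∀ {n} (R : Rel n) → HallCondition R → Matching R
hall⇒matching {n} R = go (size R) R ℕₚ.≤-refl
  where
  go : ∀ k (R : Rel n) → size R ≤ k → HallCondition R → Matching R
  deletion : ∀ k (R : Rel n) {x y} → R x y ≡ true → size R ≤ k → HallCondition (deleteEdge R x y) → Matching R

  go k R le hall with any? (λ x → any? (λ y₁ → any? (λ y₂ →
    (R x y₁ Bool.≟ true) ×-dec (R x y₂ Bool.≟ true) ×-dec ¬? (y₁ Fin.≟ y₂))))
  ... | no none = functional⇒matching R hall unique
    where
    unique : ∀ x y₁ y₂ → R x y₁ ≡ true → R x y₂ ≡ true → y₁ ≡ y₂
    unique x y₁ y₂ Rxy₁ Rxy₂ with y₁ Fin.≟ y₂
    ... | yes eq = eq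
    ... | no neq = contradiction (x , y₁ , y₂ , Rxy₁ , Rxy₂ , neq) none
  ... | yes (x , y₁ , y₂ , Rxy₁ , Rxy₂ , y₁≢y₂) with delete-one-of-two R y₁≢y₂ hall
  ...   | inj₁ hall₁ = deletion k R Rxy₁ le hall₁
  ...   | inj₂ hall₂ = deletion k R Rxy₂ le hall₂

  deletion zero R Rxy le _ = contradiction (subst (_≤ 0) (size-deleteEdge R Rxy) le) λ ()
  deletion (suc k) R {x} {y} Rxy le hall = record
    { M = M ; M⊆R = λ u v → proj₁ ∘ ∧-elim ∘ M⊆R u v ; row≡1 = row≡1 ; col≤1 = col≤1 }
    where
    open Matching (go k (deleteEdge R x y) (ℕ.s≤s⁻¹ (subst (_≤ suc k) (size-deleteEdge R Rxy) le)) hall)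

-- Fractions of natural numbers in ℚ.

open ListSum ℚ._+_ ℚ._*_ 0ℚ 1ℚ (IsCommutativeRing.isCommutativeSemiring ℚₚ.+-*-isCommutativeRing)
  ℚ._≤_ ℚₚ.≤-refl ℚₚ.+-mono-≤
  renaming (∑ to ∑ℚ; ⟦_⟧ to ⟦_⟧ℚ; ∑-cong∈ to ∑ℚ-cong∈; ∑-cong to ∑ℚ-cong; ∑-mono∈ to ∑ℚ-mono∈
           ; ∑-mono to ∑ℚ-mono; ∑-distrib-⊕ to ∑ℚ-distrib-+; ∑-*ˡ to ∑ℚ-*ˡ; ∑-swap to ∑ℚ-swap
           ; ∑-filter to ∑ℚ-filter; ∑-== to ∑ℚ-==)
  using ()

-- `ratio` divides by a gcd. In unnormalised rationals the fraction keeps its given numerator and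
-- denominator, so comparisons become cross multiplication.
toℚᵘ-ratio : ∀ a b → toℚᵘ (ratio a (suc b)) ≃ mkℚᵘ (ℤ.+ a) b
toℚᵘ-ratio a b = ℚₚ.toℚᵘ-fromℚᵘ (mkℚᵘ (ℤ.+ a) b)

ratio-≤ : ∀ a b c d → a * suc d ≤ c * suc b → ratio a (suc b) ℚ.≤ ratio c (suc d)
ratio-≤ a b c d le = ℚₚ.toℚᵘ-cancel-≤ (ℚᵘₚ.≤-respˡ-≃ (ℚᵘₚ.≃-sym (toℚᵘ-ratio a b))
  (ℚᵘₚ.≤-respʳ-≃ (ℚᵘₚ.≃-sym (toℚᵘ-ratio c d))
    (*≤* (subst₂ ℤ._≤_ (ℤₚ.pos-* a (suc d)) (ℤₚ.pos-* c (suc b)) (+≤+ le)))))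

ratio-≤⁻¹ : ∀ a b c d → ratio a (suc b) ℚ.≤ ratio c (suc d) → a * suc d ≤ c * suc b
ratio-≤⁻¹ a b c d le with ℚᵘₚ.≤-respˡ-≃ (toℚᵘ-ratio a b) (ℚᵘₚ.≤-respʳ-≃ (toℚᵘ-ratio c d) (ℚₚ.toℚᵘ-mono-≤ le))
... | *≤* le′ = ℤₚ.drop‿+≤+ (subst₂ ℤ._≤_ (sym (ℤₚ.pos-* a (suc d))) (sym (ℤₚ.pos-* c (suc b))) le′)

ratio-≡ : ∀ a b c d → a * suc d ≡ c * suc b → ratio a (suc b) ≡ ratio c (suc d)
ratio-≡ a b c d eq = ℚₚ.≤-antisym (ratio-≤ a b c d (ℕₚ.≤-reflexive eq))
  (ratio-≤ c d a b (ℕₚ.≤-reflexive (sym eq)))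

ratio-+ : ∀ a b d → ratio a (suc d) ℚ.+ ratio b (suc d) ≡ ratio (a + b) (suc d)
ratio-+ a b d = ℚₚ.toℚᵘ-injective (begin
  toℚᵘ (ratio a (suc d) ℚ.+ ratio b (suc d))           ≈⟨ ℚₚ.toℚᵘ-homo-+ (ratio a (suc d)) (ratio b (suc d)) ⟩
  toℚᵘ (ratio a (suc d)) ℚᵘ.+ toℚᵘ (ratio b (suc d))   ≈⟨ ℚᵘₚ.+-cong (toℚᵘ-ratio a d) (toℚᵘ-ratio b d) ⟩
  mkℚᵘ (ℤ.+ a) d ℚᵘ.+ mkℚᵘ (ℤ.+ b) d                       ≈⟨ *≡* eq ⟩
  mkℚᵘ (ℤ.+ (a + b)) d                                   ≈⟨ ℚᵘₚ.≃-sym (toℚᵘ-ratio (a + b) d) ⟩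
  toℚᵘ (ratio (a + b) (suc d))                         ∎)
  where
  open ℚᵘₚ.≃-Reasoning
  eq : (ℤ.+ a ℤ.* ℤ.+ suc d ℤ.+ ℤ.+ b ℤ.* ℤ.+ suc d) ℤ.* ℤ.+ suc d ≡ ℤ.+ (a + b) ℤ.* (ℤ.+ suc d ℤ.* ℤ.+ suc d)
  eq = trans (cong (ℤ._* ℤ.+ suc d) (sym (ℤₚ.*-distribʳ-+ (ℤ.+ suc d) (ℤ.+ a) (ℤ.+ b))))
             (ℤₚ.*-assoc (ℤ.+ a ℤ.+ ℤ.+ b) (ℤ.+ suc d) (ℤ.+ suc d))

ratio-0 : ∀ d → ratio 0 (suc d) ≡ 0ℚ
ratio-0 d = ratio-≡ 0 d 0 0 refl

ratio-refl : ∀ d → ratio (suc d) (suc d) ≡ 1ℚ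
ratio-refl d = ratio-≡ (suc d) d 1 0 (ℕₚ.*-comm (suc d) 1)

0≤ratio : ∀ a d → 0ℚ ℚ.≤ ratio a (suc d)
0≤ratio a d = ratio-≤ 0 0 a d z≤n

ratio-< : ∀ a b p (ε : ℚ) → ℚ.↥ ε ≡ ℤ.+ p → a * ℚ.↧ₙ ε < p * suc b → ratio a (suc b) ℚ.< ε
ratio-< a b p ε@record{} refl lt = ℚₚ.toℚᵘ-cancel-< (ℚᵘₚ.<-respˡ-≃ (ℚᵘₚ.≃-sym (toℚᵘ-ratio a b))
  (*<* (subst₂ ℤ._<_ (ℤₚ.pos-* a (ℚ.↧ₙ ε)) (ℤₚ.pos-* p (suc b)) (+<+ lt))))

positive-numerator : ∀ (ε : ℚ) → 0ℚ ℚ.< ε → ∃ λ p → ℚ.↥ ε ≡ ℤ.+ suc p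
positive-numerator (mkℚ (ℤ.+ suc p) _ _) _ = p , refl
positive-numerator (mkℚ (ℤ.+ 0) _ _) (ℚ.*<* (+<+ ()))
positive-numerator (mkℚ ℤ.-[1+ _ ] _ _) (ℚ.*<* ())

∑ℚ-ratio : ∀ {X : Set} (xs : List X) (f : X → ℕ) d → ∑ℚ xs (λ x → ratio (f x) (suc d)) ≡ ratio (∑ xs f) (suc d)
∑ℚ-ratio []       f d = sym (ratio-0 d)
∑ℚ-ratio (x ∷ xs) f d = trans (cong (ratio (f x) (suc d) ℚ.+_) (∑ℚ-ratio xs f d)) (ratio-+ (f x) (∑ xs f) d)

-- Turns the distance in `A≡1` into the density of a complement, so that convergence and its failure
-- become counting statements.
∣ratio-1∣ : ∀ a t → a ≤ suc t → ℚ.∣ ratio a (suc t) ℚ.- 1ℚ ∣ ≡ ratio (suc t ∸ a) (suc t)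
∣ratio-1∣ a t a≤t = begin
  ℚ.∣ x ℚ.- 1ℚ ∣           ≡⟨ ℚₚ.∣-p∣≡∣p∣ (x ℚ.- 1ℚ) ⟨
  ℚ.∣ ℚ.- (x ℚ.- 1ℚ) ∣     ≡⟨ cong (λ z → ℚ.∣ ℚ.- (x ℚ.- z) ∣) split ⟨
  ℚ.∣ ℚ.- (x ℚ.- (x ℚ.+ y)) ∣
    ≡⟨ cong ℚ.∣_∣ (cancel x y) ⟩
  ℚ.∣ y ∣                  ≡⟨ ℚₚ.0≤p⇒∣p∣≡p (0≤ratio (suc t ∸ a) t) ⟩
  y                        ∎
  where
  open ≡-Reasoning
  x = ratio a (suc t)
  y = ratio (suc t ∸ a) (suc t)
  split : x ℚ.+ y ≡ 1ℚ
  split = trans (ratio-+ a (suc t ∸ a) t) (trans (cong (λ z → ratio z (suc t)) (ℕₚ.m+[n∸m]≡n a≤t)) (ratio-refl t))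
  cancel : ∀ x y → ℚ.- (x ℚ.- (x ℚ.+ y)) ≡ y
  cancel x y = begin
    ℚ.- (x ℚ.- (x ℚ.+ y))               ≡⟨ cong (λ z → ℚ.- (x ℚ.+ z)) (ℚₚ.neg-distrib-+ x y) ⟩
    ℚ.- (x ℚ.+ (ℚ.- x ℚ.+ ℚ.- y))       ≡⟨ cong ℚ.-_ (sym (ℚₚ.+-assoc x (ℚ.- x) (ℚ.- y))) ⟩
    ℚ.- ((x ℚ.- x) ℚ.+ ℚ.- y)           ≡⟨ cong (λ z → ℚ.- (z ℚ.+ ℚ.- y)) (ℚₚ.+-inverseʳ x) ⟩
    ℚ.- (0ℚ ℚ.+ ℚ.- y)                  ≡⟨ cong ℚ.-_ (ℚₚ.+-identityˡ (ℚ.- y)) ⟩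
    ℚ.- (ℚ.- y)                         ≡⟨ ⁻¹-involutive y ⟩
    y                                   ∎

≤maxℚ : ∀ {x} xs → x ∈ xs → x ℚ.≤ maxℚ xs
≤maxℚ (x ∷ xs) (here refl) = ℚₚ.p≤p⊔q x (maxℚ xs)
≤maxℚ (x ∷ xs) (there x∈)  = ℚₚ.≤-trans (≤maxℚ xs x∈) (ℚₚ.p≤q⊔p x (maxℚ xs))

maxℚ≤ : ∀ {b} xs → 0ℚ ℚ.≤ b → (∀ x → x ∈ xs → x ℚ.≤ b) → maxℚ xs ℚ.≤ b
maxℚ≤ []       0≤b h = 0≤b
maxℚ≤ (x ∷ xs) 0≤b h = ℚₚ.⊔-lub (h x (here refl)) (maxℚ≤ xs 0≤b (λ y y∈ → h y (there y∈)))

≤maxℕ : ∀ {x} xs → x ∈ xs → x ≤ maxℕ xs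
≤maxℕ (x ∷ xs) (here refl) = ℕₚ.m≤m⊔n x (maxℕ xs)
≤maxℕ (x ∷ xs) (there x∈)  = ℕₚ.≤-trans (≤maxℕ xs x∈) (ℕₚ.m≤n⊔m x (maxℕ xs))

maxℕ≤ : ∀ {b} xs → (∀ x → x ∈ xs → x ≤ b) → maxℕ xs ≤ b
maxℕ≤ []       h = z≤n
maxℕ≤ (x ∷ xs) h = ℕₚ.⊔-lub (h x (here refl)) (maxℕ≤ xs (λ y y∈ → h y (there y∈)))

-- The dichotomy: a matching of the double cover or a shrinking independent set.

-- Nonemptiness of I is implied.
record Violator (G : Graph) : Set where
  field
    I           : Fin (n G) → Bool
    independent : ∀ u v → I u ≡ true → I v ≡ true → adj G u v ≡ false
    shrinking   : card (nbhd (adj G) I) < card I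

-- If |N(S)| < |S|, the isolated vertices I = S \ N(S) of G[S] satisfy N(I) ∩ S = ∅, hence
-- |S| + |N(I)| ≤ |N(S)| + |I|.
isolated-violates : (G : Graph) (S : Fin (n G) → Bool) → card (nbhd (adj G) S) < card S → Violator G
isolated-violates G S lt = record { I = I ; independent = indep ; shrinking = smaller }
  where
  N I NI : Fin (n G) → Bool
  N  = nbhd (adj G) S
  I v = S v ∧ not (N v)
  NI = nbhd (adj G) I

  indep : ∀ u v → I u ≡ true → I v ≡ true → adj G u v ≡ false
  indep u v Iu Iv with adj G u v in uv
  ... | false = refl
  ... | true  = true≢false (nbhd-intro (adj G) S (proj₁ (∧-elim Iu)) uv) (not-elim (proj₂ (∧-elim {S v} Iv)))

  NI⊆N : ∀ v → NI v ≡ true → N v ≡ true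
  NI⊆N v h with nbhd-elim (adj G) I h
  ... | u , Iu , uv = nbhd-intro (adj G) S (proj₁ (∧-elim Iu)) uv

  NI∩S : ∀ v → NI v ≡ true → S v ≡ false
  NI∩S v h with S v in Sv
  ... | false = refl
  ... | true with nbhd-elim (adj G) I h
  ...   | u , Iu , uv = true≢false (nbhd-intro (adj G) S Sv (trans (Defs.sym G v u) uv))
                                   (not-elim (proj₂ (∧-elim {S u} Iu)))

  -- A vertex of `NI` lies in `N` but not in `S`, and a vertex of `S` lies in `N` or in `I`.
  pointwise : ∀ v → ⟦ S v ⟧ + ⟦ NI v ⟧ ≤ ⟦ N v ⟧ + ⟦ I v ⟧
  pointwise v = bound (S v) (NI v) (N v) (NI⊆N v) (NI∩S v)
    where
    bound : ∀ s a b → (a ≡ true → b ≡ true) → (a ≡ true → s ≡ false) → ⟦ s ⟧ + ⟦ a ⟧ ≤ ⟦ b ⟧ + ⟦ s ∧ not b ⟧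
    bound s     true  false h₁ h₂ = true≢false (h₁ refl) refl
    bound true  true  true  h₁ h₂ = true≢false refl (h₂ refl)
    bound false true  true  h₁ h₂ = ℕₚ.≤-refl
    bound true  false true  h₁ h₂ = ℕₚ.≤-refl
    bound true  false false h₁ h₂ = ℕₚ.≤-refl
    bound false false b     h₁ h₂ = z≤n

  smaller : card NI < card I
  smaller = ℕₚ.+-cancelˡ-< (card N) _ _ (begin-strict
    card N + card NI  <⟨ ℕₚ.+-monoˡ-< (card NI) lt ⟩
    card S + card NI  ≡⟨ ∑-distrib-⊕ (allFin (n G)) _ _ ⟨
    ∑ (allFin (n G)) (λ v → ⟦ S v ⟧ + ⟦ NI v ⟧)  ≤⟨ ∑-mono (allFin (n G)) pointwise ⟩
    ∑ (allFin (n G)) (λ v → ⟦ N v ⟧ + ⟦ I v ⟧)   ≡⟨ ∑-distrib-⊕ (allFin (n G)) _ _ ⟩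
    card N + card I   ∎)
    where open ≤-Reasoning

matching-or-violator : (G : Graph) → Matching (adj G) ⊎ Violator G
matching-or-violator G with Hall? (adj G)
... | inj₁ hall     = inj₁ (hall⇒matching (adj G) hall)
... | inj₂ (S , lt) = inj₂ (isolated-violates G S lt)

module MatchingMap {n} {R : Rel n} (matching : Matching R) where
  open Matching matching

  partner : Fin n → Fin n
  partner u = proj₁ (card-witness (M u) (ℕₚ.≤-reflexive (sym (row≡1 u))))

  M-partner : ∀ u → M u (partner u) ≡ true
  M-partner u = proj₂ (card-witness (M u) (ℕₚ.≤-reflexive (sym (row≡1 u))))

  R-partner : ∀ u → R u (partner u) ≡ true
  R-partner u = M⊆R u (partner u) (M-partner u)

  -- Injectivity of `partner` in summed form: after the swap, `g v` is counted at most as often as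
  -- column `v` has entries. For an indicator, the preimage of a set is at most as large as the set.
  ∑-partner : (g : Fin n → ℕ) → ∑ (allFin n) (g ∘ partner) ≤ ∑ (allFin n) g
  ∑-partner g = begin
    ∑ (allFin n) (λ u → g (partner u))
      ≡⟨ ∑-cong (allFin n) (λ u → ∑-== n (partner u) g) ⟨
    ∑ (allFin n) (λ u → ∑ (allFin n) (λ v → ⟦ v == partner u ⟧ * g v))
      ≤⟨ ∑-mono (allFin n) (λ u → ∑-mono (allFin n) (λ v → ℕₚ.*-monoˡ-≤ (g v) (⟦⟧-mono
           (λ h → trans (cong (M u) (==⇒≡ h)) (M-partner u))))) ⟩
    ∑ (allFin n) (λ u → ∑ (allFin n) (λ v → ⟦ M u v ⟧ * g v))
      ≡⟨ ∑-swap (allFin n) (allFin n) _ ⟩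
    ∑ (allFin n) (λ v → ∑ (allFin n) (λ u → ⟦ M u v ⟧ * g v))
      ≡⟨ ∑-cong (allFin n) (λ v → trans (∑-cong (allFin n) (λ u → ℕₚ.*-comm ⟦ M u v ⟧ (g v)))
                                         (∑-*ˡ (allFin n) (g v) (λ u → ⟦ M u v ⟧))) ⟩
    ∑ (allFin n) (λ v → g v * card (λ u → M u v))
      ≤⟨ ∑-mono (allFin n) (λ v → ℕₚ.≤-trans (ℕₚ.*-monoʳ-≤ (g v) (col≤1 v))
                                           (ℕₚ.≤-reflexive (ℕₚ.*-identityʳ (g v)))) ⟩
    ∑ (allFin n) g ∎
    where open ≤-Reasoning

-- The value of `a*` in both cases.

allSubsets-complete : ∀ {k} (S : Subset k) → S ∈ allSubsets k
allSubsets-complete [] = here refl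
allSubsets-complete {suc k} (b ∷ S) =
  ∈-concatMap⁺ (λ S → (false ∷ S) ∷ (true ∷ S) ∷ []) (lose (allSubsets-complete S) (side b))
  where
  side : ∀ b → b ∷ S ∈ (false ∷ S) ∷ (true ∷ S) ∷ []
  side false = here refl
  side true  = there (here refl)

expansionRatio : (G : Graph) → Subset (n G) → ℚ
expansionRatio G S = ratio (sizeS S) (sizeS S + sizeN G S)

independentSets : (G : Graph) → List (Subset (n G))
independentSets G = filter (λ S → (independentS G S ∧ nonemptyS S) Bool.≟ true) (allSubsets (n G))

-- Stated as the negation of the test on which `a*` branches. A ratio of at most ½ for `I` would
-- give 2|I| ≤ |I| + |N(I)|.
½<a : (G : Graph) → Violator G → ¬ (aG G ℚ.≤ ½)
½<a G violator a≤½ = ℕₚ.<⇒≱ shrinking (ℕₚ.+-cancelˡ-≤ (card I) _ _ (begin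
  card I + card I                    ≡⟨ cong (card I +_) (ℕₚ.+-identityʳ (card I)) ⟨
  2 * card I                         ≡⟨ ℕₚ.*-comm 2 (card I) ⟩
  card I * 2                         ≤⟨ half (card I) (card I + card N)
    (ℕₚ.<-≤-trans (ℕₚ.≤-<-trans z≤n shrinking) (ℕₚ.m≤m+n _ _)) ratio≤½ ⟩
  card I + card N                    ∎))
  where
  open Violator violator
  open ≤-Reasoning
  N = nbhd (adj G) I
  S : Subset (n G)
  S = Vec.tabulate I

  ∈S≡I : ∀ v → ∈S S v ≡ I v
  ∈S≡I = lookup∘tabulate I

  sizeS≡ : sizeS S ≡ card I
  sizeS≡ = trans (count≡∑ (∈S S) (allFin (n G))) (card-cong ∈S≡I)

  sizeN≡ : sizeN G S ≡ card N
  sizeN≡ = trans (count≡∑ (nbhd (adj G) (∈S S)) (allFin (n G))) (card-cong (nbhd-cong (adj G) ∈S≡I))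

  indepS : independentS G S ≡ true
  indepS = all-intro (λ u → all (λ v → not (∈S S u ∧ ∈S S v ∧ adj G u v)) (allFin (n G))) (allFin (n G))
    (λ u _ → all-intro (λ v → not (∈S S u ∧ ∈S S v ∧ adj G u v)) (allFin (n G)) (λ v _ → pair u v))
    where
    pair : ∀ u v → not (∈S S u ∧ ∈S S v ∧ adj G u v) ≡ true
    pair u v rewrite ∈S≡I u | ∈S≡I v with I u in Iu | I v in Iv
    ... | false | _     = refl
    ... | true  | false = refl
    ... | true  | true  = cong not (independent u v Iu Iv)

  nonempty : nonemptyS S ≡ true
  nonempty with card-witness I (ℕₚ.≤-trans (s≤s z≤n) shrinking)
  ... | v , Iv = any-intro (∈S S) (∈-allFin v) (trans (∈S≡I v) Iv)

  ratio≤½ : ratio (card I) (card I + card N) ℚ.≤ ½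
  ratio≤½ = subst (λ q → q ℚ.≤ ½) (cong₂ (λ a b → ratio a (a + b)) sizeS≡ sizeN≡)
    (ℚₚ.≤-trans (≤maxℚ (map (expansionRatio G) (independentSets G)) (∈-map⁺ (expansionRatio G)
      (∈-filter⁺ (λ S → (independentS G S ∧ nonemptyS S) Bool.≟ true)
        (allSubsets-complete S) (∧-intro indepS nonempty)))) a≤½)

  half : ∀ a b → 0 < b → ratio a b ℚ.≤ ½ → a * 2 ≤ b
  half a (suc b) _ le = ℕₚ.≤-trans (ratio-≤⁻¹ a b 1 1 le) (ℕₚ.≤-reflexive (ℕₚ.*-identityˡ (suc b)))

a*≡1 : (G : Graph) → Violator G → a* G ≡ 1ℚ
a*≡1 G violator with aG G ℚ.≤? ½
... | yes a≤½ = contradiction a≤½ (½<a G violator)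
... | no  _   = refl

a≤½ : (G : Graph) → Matching (adj G) → aG G ℚ.≤ ½
a≤½ G matching = maxℚ≤ (map (expansionRatio G) (independentSets G)) (ratio-≤ 0 0 1 1 z≤n) bound
  where
  open MatchingMap matching

  -- `partner` sends `S` into its neighbourhood, so `S` is contained in the preimage of N(S).
  card≤ : ∀ S → card S ≤ card (nbhd (adj G) S)
  card≤ S = ℕₚ.≤-trans (card-mono (λ v Sv → nbhd-intro (adj G) S Sv (R-partner v)))
                       (∑-partner (⟦_⟧ ∘ nbhd (adj G) S))

  half : ∀ a b → a ≤ b → ratio a (a + b) ℚ.≤ ½
  half a b a≤b with a + b in eq
  -- The denominator 0 yields the default value 0 of `ratio`.
  ... | zero  = ratio-≤ 0 0 1 1 z≤n
  ... | suc c = ratio-≤ a c 1 1 (begin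
    a * 2      ≡⟨ ℕₚ.*-comm a 2 ⟩
    a + (a + 0)  ≡⟨ cong (a +_) (ℕₚ.+-identityʳ a) ⟩
    a + a      ≤⟨ ℕₚ.+-monoʳ-≤ a a≤b ⟩
    a + b      ≡⟨ eq ⟩
    suc c      ≡⟨ ℕₚ.*-identityˡ (suc c) ⟨
    1 * suc c  ∎)
    where open ≤-Reasoning

  bound : ∀ x → x ∈ map (expansionRatio G) (independentSets G) → x ℚ.≤ ½
  bound x x∈ with ∈-map⁻ (expansionRatio G) x∈
  ... | S , _ , refl = half (sizeS S) (sizeN G S)
          (subst₂ _≤_ (sym (count≡∑ (∈S S) (allFin (n G))))
                      (sym (count≡∑ (nbhd (adj G) (∈S S)) (allFin (n G)))) (card≤ (∈S S)))

a*≢1 : (G : Graph) → Matching (adj G) → a* G ≢ 1ℚ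
a*≢1 G matching a*≡1 with aG G ℚ.≤? ½
... | yes _   = contradiction (ratio-≤⁻¹ 1 0 1 1 (subst (λ q → q ℚ.≤ ½) a*≡1 (a≤½ G matching))) λ { (s≤s ()) }
... | no  ¬le = ¬le (a≤½ G matching)

-- Fractional perfect matchings: construction and obstruction.

isEdge : (G : Graph) → Fin (n G) → Fin (n G) → Bool
isEdge G u v = ⌊ toℕ u <? toℕ v ⌋ ∧ adj G u v

∑-edges : (G : Graph) (g : Fin (n G) × Fin (n G) → ℕ) →
  ∑ (edges G) g ≡ ∑ (allFin (n G)) (λ u → ∑ (allFin (n G)) (λ v → ⟦ isEdge G u v ⟧ * g (u , v)))
∑-edges G g = trans (∑-concatMap _ (allFin (n G)) g) (∑-cong (allFin (n G)) (λ u →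
  trans (∑-map (u ,_) (filter (λ v → isEdge G u v Bool.≟ true) (allFin (n G))) g)
        (∑-filter (isEdge G u) (allFin (n G)) (λ v → g (u , v)))))

∈-edges : (G : Graph) {e : Fin (n G) × Fin (n G)} → e ∈ edges G → adj G (proj₁ e) (proj₂ e) ≡ true
∈-edges G e∈ with find (∈-concatMap⁻ (λ u → map (λ v → u , v)
  (filter (λ v → isEdge G u v Bool.≟ true) (allFin (n G)))) {xs = allFin (n G)} e∈)
... | u , _ , e∈u with ∈-map⁻ (u ,_) e∈u
...   | v , v∈ , refl = proj₂ (∧-elim {⌊ toℕ u <? toℕ v ⌋}
          (proj₂ (∈-filter⁻ (λ v → isEdge G u v Bool.≟ true) {xs = allFin (n G)} v∈)))

-- Each edge appears in edges G with one orientation only.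
∑-edges-symmetrized : (G : Graph) (F : Fin (n G) → Fin (n G) → ℕ) →
  (∀ u v → adj G u v ≡ false → F u v ≡ 0) →
  ∑ (edges G) (λ (u , v) → F u v + F v u) ≡ ∑ (allFin (n G)) (λ u → ∑ (allFin (n G)) (F u))
∑-edges-symmetrized G F support = begin
  ∑ (edges G) (λ (u , v) → F u v + F v u)
    ≡⟨ ∑-edges G _ ⟩
  ∑ V (λ u → ∑ V (λ v → L u v * (F u v + F v u)))
    ≡⟨ ∑-cong V (λ u → trans (∑-cong V (λ v → ℕₚ.*-distribˡ-+ (L u v) (F u v) (F v u))) (∑-distrib-⊕ V _ _)) ⟩
  ∑ V (λ u → ∑ V (λ v → L u v * F u v) + ∑ V (λ v → L u v * F v u))
    ≡⟨ ∑-distrib-⊕ V _ _ ⟩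
  ∑ V (λ u → ∑ V (λ v → L u v * F u v)) + ∑ V (λ u → ∑ V (λ v → L u v * F v u))
    ≡⟨ cong (∑ V (λ u → ∑ V (λ v → L u v * F u v)) +_) (∑-swap V V (λ u v → L u v * F v u)) ⟩
  ∑ V (λ u → ∑ V (λ v → L u v * F u v)) + ∑ V (λ u → ∑ V (λ v → L v u * F u v))
    ≡⟨ ∑-distrib-⊕ V _ _ ⟨
  ∑ V (λ u → ∑ V (λ v → L u v * F u v) + ∑ V (λ v → L v u * F u v))
    ≡⟨ ∑-cong V (λ u → trans (sym (∑-distrib-⊕ V _ _)) (∑-cong V (one-orientation u))) ⟩
  ∑ V (λ u → ∑ V (F u)) ∎
  where
  open ≡-Reasoning
  V = allFin (n G)
  L : Fin (n G) → Fin (n G) → ℕ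
  L u v = ⟦ isEdge G u v ⟧

  one-orientation : ∀ u v → L u v * F u v + L v u * F u v ≡ F u v
  one-orientation u v with adj G u v in uv
  ... | false rewrite support u v uv = cong₂ _+_ (ℕₚ.*-zeroʳ ⟦ ⌊ toℕ u <? toℕ v ⌋ ∧ false ⟧) (ℕₚ.*-zeroʳ (L v u))
  ... | true rewrite trans (Defs.sym G v u) uv with toℕ u <? toℕ v | toℕ v <? toℕ u
  ...   | yes u<v | yes v<u = contradiction v<u (ℕₚ.<-asym u<v)
  ...   | yes _   | no  _   = trans (ℕₚ.+-identityʳ (F u v + 0)) (ℕₚ.+-identityʳ (F u v))
  ...   | no  _   | yes _   = ℕₚ.+-identityʳ (F u v)
  ...   | no u≮v  | no v≮u  = true≢false uv (subst (λ w → adj G u w ≡ false)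
            (toℕ-injective (ℕₚ.≤-antisym (ℕₚ.≮⇒≥ v≮u) (ℕₚ.≮⇒≥ u≮v))) (irrfl G u))

-- The total weight is half the sum of all rows of `M`, which is n/2. The weight at `w` is at most
-- half of row `w` plus column `w`, hence at most 1.
matching⇒fractional : (G : Graph) → Matching (adj G) → HasFractionalPerfectMatching G
matching⇒fractional G matching = record { f = f ; nonneg = nonneg ; vertex≤ = vertex≤ } , perfect
  where
  open Matching matching
  V = allFin (n G)
  m : Fin (n G) → Fin (n G) → ℕ
  m u v = ⟦ M u v ⟧
  f : Fin (n G) → Fin (n G) → ℚ
  f u v = ratio (m u v + m v u) 2

  outside : ∀ u v → adj G u v ≡ false → m u v ≡ 0
  outside u v uv with M u v in Muv
  ... | false = refl
  ... | true  = true≢false (M⊆R u v Muv) uv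

  nonneg : ∀ e → e ∈ edges G → 0ℚ ℚ.≤ edgeWeight G f e
  nonneg (u , v) _ = 0≤ratio (m u v + m v u) 1

  perfect : sumℚ (map (edgeWeight G f) (edges G)) ≡ ratio (n G) 2
  perfect = trans (∑ℚ-ratio (edges G) (λ (u , v) → m u v + m v u) 1) (cong (λ s → ratio s 2)
    (trans (∑-edges-symmetrized G m outside) (trans (∑-cong V row≡1) (∑-1 (n G)))))

  vertex≤ : ∀ w → sumℚ (map (edgeWeight G f) (incident G w)) ℚ.≤ 1ℚ
  vertex≤ w = subst (ℚ._≤ 1ℚ) (sym (∑ℚ-ratio (incident G w) (λ (u , v) → m u v + m v u) 1))
    (ratio-≤ degree 1 1 0 (ℕₚ.≤-trans (ℕₚ.≤-reflexive (ℕₚ.*-identityʳ degree)) degree≤2))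
    where
    open ≤-Reasoning
    touches : Fin (n G) → Fin (n G) → ℕ
    touches u v = ⟦ (u == w) ∨ (v == w) ⟧

    degree : ℕ
    degree = ∑ (incident G w) (λ (u , v) → m u v + m v u)

    touches-sym : ∀ u v → touches u v ≡ touches v u
    touches-sym u v = cong ⟦_⟧ (∨-comm (u == w) (v == w))

    ⟦∨⟧≤ : ∀ a b → ⟦ a ∨ b ⟧ ≤ ⟦ a ⟧ + ⟦ b ⟧
    ⟦∨⟧≤ a b = ℕₚ.≤-trans (ℕₚ.m≤m+n ⟦ a ∨ b ⟧ ⟦ a ∧ b ⟧) (ℕₚ.≤-reflexive (⟦⟧-∨-∧ a b))

    degree≤2 : degree ≤ 2
    degree≤2 = begin
      degree
        ≡⟨ ∑-filter (λ e → (proj₁ e == w) ∨ (proj₂ e == w)) (edges G) _ ⟩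
      ∑ (edges G) (λ (u , v) → touches u v * (m u v + m v u))
        ≡⟨ ∑-cong (edges G) (λ (u , v) → trans (ℕₚ.*-distribˡ-+ (touches u v) (m u v) (m v u))
             (cong (λ t → touches u v * m u v + t * m v u) (touches-sym u v))) ⟩
      ∑ (edges G) (λ (u , v) → touches u v * m u v + touches v u * m v u)
        ≡⟨ ∑-edges-symmetrized G (λ u v → touches u v * m u v)
             (λ u v uv → trans (cong (touches u v *_) (outside u v uv)) (ℕₚ.*-zeroʳ (touches u v))) ⟩
      ∑ V (λ u → ∑ V (λ v → touches u v * m u v))
        ≤⟨ ∑-mono V (λ u → ∑-mono V (λ v → ℕₚ.*-monoˡ-≤ (m u v) (⟦∨⟧≤ (u == w) (v == w)))) ⟩
      ∑ V (λ u → ∑ V (λ v → (⟦ u == w ⟧ + ⟦ v == w ⟧) * m u v))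
        ≡⟨ ∑-cong V (λ u → trans (∑-cong V (λ v → ℕₚ.*-distribʳ-+ (m u v) ⟦ u == w ⟧ ⟦ v == w ⟧))
             (trans (∑-distrib-⊕ V _ _) (cong₂ _+_ (∑-*ˡ V ⟦ u == w ⟧ (m u)) (∑-== (n G) w (m u))))) ⟩
      ∑ V (λ u → ⟦ u == w ⟧ * ∑ V (m u) + m u w)
        ≡⟨ trans (∑-distrib-⊕ V _ _) (cong (_+ ∑ V (λ u → m u w)) (∑-== (n G) w (λ u → ∑ V (m u)))) ⟩
      ∑ V (m w) + ∑ V (λ u → m u w)
        ≤⟨ ℕₚ.+-mono-≤ (ℕₚ.≤-reflexive (row≡1 w)) (col≤1 w) ⟩
      2 ∎

-- Weak duality: c = 1 - [I] + [N(I)] is a fractional vertex cover (scaled by 2) of total weight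
-- n - |I| + |N(I)| < n.
violator⇒¬fractional : (G : Graph) → Violator G → ¬ HasFractionalPerfectMatching G
violator⇒¬fractional G violator (fm , perfect) = ℕₚ.<⇒≱ cover<n n≤cover
  where
  open Violator violator
  open FractionalMatching fm
  V = allFin (n G)
  E = edges G
  N = nbhd (adj G) I

  c : Fin (n G) → ℕ
  c w = ⟦ not (I w) ⟧ + ⟦ N w ⟧

  cover<n : ∑ V c < n G
  cover<n = begin-strict
    ∑ V c                        ≡⟨ ∑-distrib-⊕ V _ _ ⟩
    card (not ∘ I) + card N      <⟨ ℕₚ.+-monoʳ-< (card (not ∘ I)) shrinking ⟩
    card (not ∘ I) + card I      ≡⟨ ∑-distrib-⊕ V _ _ ⟨
    ∑ V (λ w → ⟦ not (I w) ⟧ + ⟦ I w ⟧)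
      ≡⟨ ∑-cong V (λ w → trans (ℕₚ.+-comm ⟦ not (I w) ⟧ ⟦ I w ⟧) (⟦⟧-complement (I w))) ⟩
    ∑ V (λ _ → 1)                ≡⟨ ∑-1 (n G) ⟩
    n G ∎
    where
    open ≤-Reasoning

  -- An end in `I` may contribute 0, but then the other end lies outside `I` and inside N(I) and
  -- contributes 2. Two ends outside `I` contribute at least 1 each.
  covers : ∀ u v → adj G u v ≡ true → 2 ≤ c u + c v
  covers u v uv = bound (I u) (I v) (N u) (N v)
    (λ Iv → nbhd-intro (adj G) I Iv (trans (Defs.sym G v u) uv))
    (λ Iu → nbhd-intro (adj G) I Iu uv)
    (λ (Iu , Iv) → true≢false uv (independent u v Iu Iv))
    where
    bound : ∀ a b a′ b′ → (b ≡ true → a′ ≡ true) → (a ≡ true → b′ ≡ true) → ¬ (a ≡ true × b ≡ true) →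
            2 ≤ ⟦ not a ⟧ + ⟦ a′ ⟧ + (⟦ not b ⟧ + ⟦ b′ ⟧)
    bound true  true  a′ b′ _ _ h = contradiction (refl , refl) h
    bound true  false a′ b′ _ h _ rewrite h refl = ℕₚ.m≤n+m 2 ⟦ a′ ⟧
    bound false true  a′ b′ h _ _ rewrite h refl = ℕₚ.m≤m+n 2 ⟦ b′ ⟧
    bound false false a′ b′ _ _ _ = s≤s (ℕₚ.≤-trans (s≤s z≤n) (ℕₚ.m≤n+m (1 + ⟦ b′ ⟧) ⟦ a′ ⟧))

  ι : ℕ → ℚ
  ι a = ratio a 1

  w : Fin (n G) × Fin (n G) → ℚ
  w = edgeWeight G f

  open ℚₚ.≤-Reasoning

  edge-bound : ∀ e → e ∈ E → w e ℚ.+ w e ℚ.≤ w e ℚ.* (ι (c (proj₁ e)) ℚ.+ ι (c (proj₂ e)))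
  edge-bound e@(u , v) e∈ = begin
    w e ℚ.+ w e                     ≡⟨ cong₂ ℚ._+_ (ℚₚ.*-identityʳ (w e)) (ℚₚ.*-identityʳ (w e)) ⟨
    w e ℚ.* 1ℚ ℚ.+ w e ℚ.* 1ℚ       ≡⟨ ℚₚ.*-distribˡ-+ (w e) 1ℚ 1ℚ ⟨
    w e ℚ.* ι 2                     ≤⟨ ℚₚ.*-monoˡ-≤-nonNeg (w e) {{ℚ.nonNegative (nonneg e e∈)}}
                                         (ratio-≤ 2 0 (c u + c v) 0 (ℕₚ.*-monoˡ-≤ 1 (covers u v (∈-edges G e∈)))) ⟩
    w e ℚ.* ι (c u + c v)           ≡⟨ cong (w e ℚ.*_) (ratio-+ (c u) (c v) 0) ⟨
    w e ℚ.* (ι (c u) ℚ.+ ι (c v))   ∎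

  ⟦_∋_⟧ : Fin (n G) × Fin (n G) → Fin (n G) → ℚ
  ⟦ e ∋ x ⟧ = ⟦ (proj₁ e == x) ∨ (proj₂ e == x) ⟧ℚ

  ∑-ends : ∀ e → e ∈ E → ∑ℚ V (λ x → ⟦ e ∋ x ⟧ ℚ.* ι (c x)) ≡ ι (c (proj₁ e)) ℚ.+ ι (c (proj₂ e))
  ∑-ends e@(u , v) e∈ = begin-equality
    ∑ℚ V (λ x → ⟦ e ∋ x ⟧ ℚ.* ι (c x))
      ≡⟨ ∑ℚ-cong V (λ x → trans (cong (ℚ._* ι (c x)) (split x))
           (ℚₚ.*-distribʳ-+ (ι (c x)) ⟦ x == u ⟧ℚ ⟦ x == v ⟧ℚ)) ⟩
    ∑ℚ V (λ x → ⟦ x == u ⟧ℚ ℚ.* ι (c x) ℚ.+ ⟦ x == v ⟧ℚ ℚ.* ι (c x))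
      ≡⟨ ∑ℚ-distrib-+ V (λ x → ⟦ x == u ⟧ℚ ℚ.* ι (c x)) (λ x → ⟦ x == v ⟧ℚ ℚ.* ι (c x)) ⟩
    ∑ℚ V (λ x → ⟦ x == u ⟧ℚ ℚ.* ι (c x)) ℚ.+ ∑ℚ V (λ x → ⟦ x == v ⟧ℚ ℚ.* ι (c x))
      ≡⟨ cong₂ ℚ._+_ (∑ℚ-== (n G) u (ι ∘ c)) (∑ℚ-== (n G) v (ι ∘ c)) ⟩
    ι (c u) ℚ.+ ι (c v) ∎
    where
    -- Inclusion-exclusion without correction: the two ends of an edge are distinct because `adj` is
    -- irreflexive.
    split : ∀ x → ⟦ e ∋ x ⟧ ≡ ⟦ x == u ⟧ℚ ℚ.+ ⟦ x == v ⟧ℚ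
    split x with u Fin.≟ x | v Fin.≟ x
    ... | yes refl | yes refl = true≢false (∈-edges G e∈) (irrfl G u)
    ... | yes refl | no v≢u rewrite ==-refl u | ≢⇒== (v≢u ∘ sym) = refl
    ... | no u≢v | yes refl rewrite ==-refl v | ≢⇒== (u≢v ∘ sym) = refl
    ... | no u≢x | no v≢x rewrite ≢⇒== (u≢x ∘ sym) | ≢⇒== (v≢x ∘ sym) = refl

  degree : Fin (n G) → ℚ
  degree x = ∑ℚ E (λ e → ⟦ e ∋ x ⟧ ℚ.* w e)

  degree≤1 : ∀ x → degree x ℚ.≤ 1ℚ
  degree≤1 x = subst (ℚ._≤ 1ℚ) (∑ℚ-filter (λ e → (proj₁ e == x) ∨ (proj₂ e == x)) E w) (vertex≤ x)

  double-counting : ∑ℚ E (λ e → w e ℚ.* (ι (c (proj₁ e)) ℚ.+ ι (c (proj₂ e)))) ≡ ∑ℚ V (λ x → ι (c x) ℚ.* degree x)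
  double-counting = begin-equality
    ∑ℚ E (λ e → w e ℚ.* (ι (c (proj₁ e)) ℚ.+ ι (c (proj₂ e))))
      ≡⟨ ∑ℚ-cong∈ E (λ e e∈ → trans (cong (w e ℚ.*_) (sym (∑-ends e e∈)))
           (sym (∑ℚ-*ˡ V (w e) (λ x → ⟦ e ∋ x ⟧ ℚ.* ι (c x))))) ⟩
    ∑ℚ E (λ e → ∑ℚ V (λ x → w e ℚ.* (⟦ e ∋ x ⟧ ℚ.* ι (c x))))
      ≡⟨ ∑ℚ-swap E V (λ e x → w e ℚ.* (⟦ e ∋ x ⟧ ℚ.* ι (c x))) ⟩
    ∑ℚ V (λ x → ∑ℚ E (λ e → w e ℚ.* (⟦ e ∋ x ⟧ ℚ.* ι (c x))))
      ≡⟨ ∑ℚ-cong V (λ x → trans (∑ℚ-cong E (λ e → rotate (w e) ⟦ e ∋ x ⟧ (ι (c x))))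
           (∑ℚ-*ˡ E (ι (c x)) (λ e → ⟦ e ∋ x ⟧ ℚ.* w e))) ⟩
    ∑ℚ V (λ x → ι (c x) ℚ.* degree x) ∎
    where
    rotate : ∀ a b d → a ℚ.* (b ℚ.* d) ≡ d ℚ.* (b ℚ.* a)
    rotate a b d = trans (ℚₚ.*-comm a (b ℚ.* d)) (trans (cong (ℚ._* a) (ℚₚ.*-comm b d)) (ℚₚ.*-assoc d b a))

  double : ∀ a → a * 2 ≡ (a + a) * 1
  double = solve-∀

  -- Twice the total weight is n; each edge is charged to its ends through the cover, and every
  -- vertex carries weight at most 1.
  n≤cover : n G ≤ ∑ V c
  n≤cover = subst₂ _≤_ (ℕₚ.*-identityʳ (n G)) (ℕₚ.*-identityʳ (∑ V c)) (ratio-≤⁻¹ (n G) 0 (∑ V c) 0 (begin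
    ι (n G)
      ≡⟨ ratio-≡ (n G) 0 (n G + n G) 1 (double (n G)) ⟩
    ratio (n G + n G) 2
      ≡⟨ ratio-+ (n G) (n G) 1 ⟨
    ratio (n G) 2 ℚ.+ ratio (n G) 2
      ≡⟨ cong₂ ℚ._+_ perfect perfect ⟨
    ∑ℚ E w ℚ.+ ∑ℚ E w
      ≡⟨ ∑ℚ-distrib-+ E w w ⟨
    ∑ℚ E (λ e → w e ℚ.+ w e)
      ≤⟨ ∑ℚ-mono∈ E edge-bound ⟩
    ∑ℚ E (λ e → w e ℚ.* (ι (c (proj₁ e)) ℚ.+ ι (c (proj₂ e))))
      ≡⟨ double-counting ⟩
    ∑ℚ V (λ x → ι (c x) ℚ.* degree x)
      ≤⟨ ∑ℚ-mono V (λ x → ℚₚ.*-monoˡ-≤-nonNeg (ι (c x)) {{ℚ.nonNegative (0≤ratio (c x) 0)}} (degree≤1 x)) ⟩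
    ∑ℚ V (λ x → ι (c x) ℚ.* 1ℚ)
      ≡⟨ ∑ℚ-cong V (λ x → ℚₚ.*-identityʳ (ι (c x))) ⟩
    ∑ℚ V (λ x → ι (c x))
      ≡⟨ ∑ℚ-ratio V c 0 ⟩
    ι (∑ V c) ∎))

-- Sums over the vertices of a tensor power, and its independence number.

∑-allVecs : ∀ k m (g : Vec (Fin k) (suc m) → ℕ) →
  ∑ (allVecs k (suc m)) g ≡ ∑ (allFin k) (λ u → ∑ (allVecs k m) (λ x → g (u ∷ x)))
∑-allVecs k m g = trans (∑-concatMap (λ u → map (u ∷_) (allVecs k m)) (allFin k) g)
  (∑-cong (allFin k) (λ u → ∑-map (u ∷_) (allVecs k m) g))

∏ : ∀ {k m} → (Fin k → ℕ) → Vec (Fin k) m → ℕ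
∏ w []      = 1
∏ w (u ∷ x) = w u * ∏ w x

-- Independence of the coordinates: the moment of a product weight factors. The weight 1 recovers
-- the number of vertices, a general one the exponential moment.
∑-∏ : ∀ k m (w : Fin k → ℕ) → ∑ (allVecs k m) (∏ w) ≡ ∑ (allFin k) w ^ m
∑-∏ k zero    w = refl
∑-∏ k (suc m) w = begin
  ∑ (allVecs k (suc m)) (∏ w)                               ≡⟨ ∑-allVecs k m (∏ w) ⟩
  ∑ (allFin k) (λ u → ∑ (allVecs k m) (λ x → w u * ∏ w x))
    ≡⟨ ∑-cong (allFin k) (λ u → trans (∑-*ˡ (allVecs k m) (w u) (∏ w)) (ℕₚ.*-comm (w u) _)) ⟩
  ∑ (allFin k) (λ u → ∑ (allVecs k m) (∏ w) * w u)          ≡⟨ ∑-*ˡ (allFin k) (∑ (allVecs k m) (∏ w)) w ⟩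
  ∑ (allVecs k m) (∏ w) * ∑ (allFin k) w                    ≡⟨ ℕₚ.*-comm (∑ (allVecs k m) (∏ w)) _ ⟩
  ∑ (allFin k) w * ∑ (allVecs k m) (∏ w)                    ≡⟨ cong (∑ (allFin k) w *_) (∑-∏ k m w) ⟩
  ∑ (allFin k) w ^ suc m                                    ∎
  where open ≡-Reasoning

∑-allVecs-1 : ∀ k m → ∑ (allVecs k m) (λ _ → 1) ≡ k ^ m
∑-allVecs-1 k m = trans (∑-cong (allVecs k m) (sym ∘ ∏-1)) (trans (∑-∏ k m (λ _ → 1)) (cong (_^ m) (∑-1 k)))
  where
  ∏-1 : ∀ {m} (x : Vec (Fin k) m) → ∏ (λ _ → 1) x ≡ 1
  ∏-1 []      = refl
  ∏-1 (u ∷ x) = trans (ℕₚ.+-identityʳ (∏ (λ _ → 1) x)) (∏-1 x)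

module _ {X : Set} where

  extend : X → List X → List (List X)
  extend x ys = ys ∷ (x ∷ ys) ∷ []

  filter∈sublists : (p : X → Bool) (xs : List X) → filter (λ x → p x Bool.≟ true) xs ∈ sublists xs
  filter∈sublists p []       = here refl
  filter∈sublists p (x ∷ xs) with p x
  ... | true  = ∈-concatMap⁺ (extend x) (lose (filter∈sublists p xs) (there (here refl)))
  ... | false = ∈-concatMap⁺ (extend x) (lose (filter∈sublists p xs) (here refl))

  -- Stands in for the absence of repetitions: sums over a member of `sublists xs` never exceed
  -- those over `xs`.
  ∑-sublist : (xs : List X) {ys : List X} → ys ∈ sublists xs → (g : X → ℕ) → ∑ ys g ≤ ∑ xs g
  ∑-sublist []       (here refl) g = z≤n
  ∑-sublist (x ∷ xs) ys∈ g with find (∈-concatMap⁻ (extend x) {xs = sublists xs} ys∈)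
  ... | zs , zs∈ , here refl         = ℕₚ.≤-trans (∑-sublist xs zs∈ g) (ℕₚ.m≤n+m (∑ xs g) (g x))
  ... | zs , zs∈ , there (here refl) = ℕₚ.+-monoʳ-≤ (g x) (∑-sublist xs zs∈ g)

  length≡∑ : (xs : List X) → length xs ≡ ∑ xs (λ _ → 1)
  length≡∑ []       = refl
  length≡∑ (x ∷ xs) = cong suc (length≡∑ xs)

  independentL-intro : (a : X → X → Bool) (xs : List X) →
    (∀ x y → x ∈ xs → y ∈ xs → a x y ≡ false) → independentL a xs ≡ true
  independentL-intro a xs h = all-intro (λ x → all (λ y → not (a x y)) xs) xs (λ x x∈ →
    all-intro (λ y → not (a x y)) xs (λ y y∈ → cong not (h x y x∈ y∈)))

  independentL-elim : (a : X → X → Bool) {xs : List X} → independentL a xs ≡ true →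
    ∀ {x y} → x ∈ xs → y ∈ xs → a x y ≡ false
  independentL-elim a {xs} h {x} x∈ y∈ = not-elim (all-elim (λ y → not (a x y))
    (all-elim (λ x → all (λ y → not (a x y)) xs) h x∈) y∈)

module _ (G : Graph) (m : ℕ) where

  powVertices : List (Vec (Fin (n G)) m)
  powVertices = allVecs (n G) m

  powIndependentSets : List (List (Vec (Fin (n G)) m))
  powIndependentSets = filter (λ I → independentL (powAdj G m) I Bool.≟ true) (sublists powVertices)

  αPow-lower : ∀ {I} → I ∈ sublists powVertices → independentL (powAdj G m) I ≡ true → length I ≤ αPow G m
  αPow-lower I∈ indep = ≤maxℕ (map length powIndependentSets)
    (∈-map⁺ length (∈-filter⁺ (λ I → independentL (powAdj G m) I Bool.≟ true) I∈ indep))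

  αPow-upper : ∀ b →
    (∀ {I} → I ∈ sublists powVertices → independentL (powAdj G m) I ≡ true → length I ≤ b) → αPow G m ≤ b
  αPow-upper b h = maxℕ≤ (map length powIndependentSets) bound
    where
    bound : ∀ l → l ∈ map length powIndependentSets → l ≤ b
    bound l l∈ with ∈-map⁻ length l∈
    ... | I , I∈ , refl
      with ∈-filter⁻ (λ I → independentL (powAdj G m) I Bool.≟ true) {xs = sublists powVertices} I∈
    ...   | I∈sub , indep = h I∈sub indep

  αPow≤ : αPow G m ≤ n G ^ m
  αPow≤ = αPow-upper (n G ^ m) (λ {I} I∈ _ → subst₂ _≤_ (sym (length≡∑ I)) (∑-allVecs-1 (n G) m)
    (∑-sublist powVertices I∈ (λ _ → 1)))

-- The matching case: independent sets of a power fill at most half of it.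

-- For a matching π of the double cover, x ↦ π ∘ x maps an independent set of G^m into its
-- neighbourhood, which is disjoint from it, and does not increase cardinalities.
module _ (G : Graph) (matching : Matching (adj G)) where
  open MatchingMap matching

  ∑-map-partner : ∀ m (g : Vec (Fin (n G)) m → ℕ) →
    ∑ (allVecs (n G) m) (g ∘ Vec.map partner) ≤ ∑ (allVecs (n G) m) g
  ∑-map-partner zero    g = ℕₚ.≤-refl
  ∑-map-partner (suc m) g = begin
    ∑ (allVecs (n G) (suc m)) (g ∘ Vec.map partner)
      ≡⟨ ∑-allVecs (n G) m (g ∘ Vec.map partner) ⟩
    ∑ (allFin (n G)) (λ u → ∑ (allVecs (n G) m) (λ x → g (partner u ∷ Vec.map partner x)))
      ≤⟨ ∑-mono (allFin (n G)) (λ u → ∑-map-partner m (λ x → g (partner u ∷ x))) ⟩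
    ∑ (allFin (n G)) (λ u → ∑ (allVecs (n G) m) (λ x → g (partner u ∷ x)))
      ≤⟨ ∑-partner (λ u → ∑ (allVecs (n G) m) (λ x → g (u ∷ x))) ⟩
    ∑ (allFin (n G)) (λ u → ∑ (allVecs (n G) m) (λ x → g (u ∷ x)))
      ≡⟨ ∑-allVecs (n G) m g ⟨
    ∑ (allVecs (n G) (suc m)) g ∎
    where open ≤-Reasoning

  adj-map-partner : ∀ {m} (x : Vec (Fin (n G)) m) → powAdj G m (Vec.map partner x) x ≡ true
  adj-map-partner []      = refl
  adj-map-partner (u ∷ x) = ∧-intro (trans (Defs.sym G (partner u) u) (R-partner u)) (adj-map-partner x)

  independent-half : ∀ m {I} → I ∈ sublists (allVecs (n G) m) → independentL (powAdj G m) I ≡ true →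
    length I + length I ≤ n G ^ m
  independent-half m {I} I∈ indep = begin
    length I + length I
      ≤⟨ ℕₚ.+-mono-≤ inside outside ⟩
    ∑ L (λ x → ⟦ h x ⟧) + ∑ L (λ x → ⟦ not (h x) ⟧)
      ≡⟨ ∑-distrib-⊕ L _ _ ⟨
    ∑ L (λ x → ⟦ h x ⟧ + ⟦ not (h x) ⟧)
      ≡⟨ ∑-cong L (λ x → ⟦⟧-complement (h x)) ⟩
    ∑ L (λ _ → 1)
      ≡⟨ ∑-allVecs-1 (n G) m ⟩
    n G ^ m ∎
    where
    open ≤-Reasoning
    L = allVecs (n G) m
    h : Vec (Fin (n G)) m → Bool
    h x = any (powAdj G m x) I

    inside : length I ≤ ∑ L (λ x → ⟦ h x ⟧)
    inside = begin
      length I                               ≡⟨ length≡∑ I ⟩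
      ∑ I (λ _ → 1)
        ≤⟨ ∑-mono∈ I (λ x x∈ → ⟦⟧-mono {true} (λ _ →
             any-intro (powAdj G m (Vec.map partner x)) x∈ (adj-map-partner x))) ⟩
      ∑ I (λ x → ⟦ h (Vec.map partner x) ⟧)  ≤⟨ ∑-sublist L I∈ _ ⟩
      ∑ L (λ x → ⟦ h (Vec.map partner x) ⟧)  ≤⟨ ∑-map-partner m (⟦_⟧ ∘ h) ⟩
      ∑ L (λ x → ⟦ h x ⟧)                    ∎

    outside : length I ≤ ∑ L (λ x → ⟦ not (h x) ⟧)
    outside = begin
      length I                   ≡⟨ length≡∑ I ⟩
      ∑ I (λ _ → 1)              ≤⟨ ∑-mono∈ I (λ x x∈ → ⟦⟧-mono {true} (λ _ → not-h x x∈)) ⟩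
      ∑ I (λ x → ⟦ not (h x) ⟧)  ≤⟨ ∑-sublist L I∈ _ ⟩
      ∑ L (λ x → ⟦ not (h x) ⟧)  ∎
      where
      not-h : ∀ x → x ∈ I → not (h x) ≡ true
      not-h x x∈ with h x in hx
      ... | false = refl
      ... | true with any-elim (powAdj G m x) I hx
      ...   | y , y∈ , xy = true≢false xy (independentL-elim (powAdj G m) {I} indep x∈ y∈)

  -- `αPow-upper` wants a bound on the length itself, hence the detour through the floor of half the
  -- number of vertices, which loses nothing for integers.
  αPow-half : ∀ m → αPow G m + αPow G m ≤ n G ^ m
  αPow-half m = halves (αPow-upper G m ℕ.⌊ n G ^ m /2⌋ (λ I∈ indep → ≤half (independent-half m I∈ indep)))
    where
    ≤half : ∀ {a b} → a + a ≤ b → a ≤ ℕ.⌊ b /2⌋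
    ≤half {a} le = subst (_≤ _) (sym (ℕₚ.n≡⌊n+n/2⌋ a)) (ℕₚ.⌊n/2⌋-mono le)
    halves : ∀ {a b} → a ≤ ℕ.⌊ b /2⌋ → a + a ≤ b
    halves {a} {b} le = ℕₚ.≤-trans (ℕₚ.+-mono-≤ le (ℕₚ.≤-trans le (ℕₚ.⌊n/2⌋≤⌈n/2⌉ b)))
                                   (ℕₚ.≤-reflexive (ℕₚ.⌊n/2⌋+⌈n/2⌉≡n b))

^-positive : ∀ {a} m → 1 ≤ a → 1 ≤ a ^ m
^-positive {suc a} m _ = ℕₚ.m^n>0 (suc a) m

-- Keeps `t` abstract, since `n G ^ m` is not syntactically a successor.
distance-to-1 : ∀ a t → 1 ≤ t → a ≤ t → ℚ.∣ ratio a t ℚ.- 1ℚ ∣ ≡ ratio (t ∸ a) t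
distance-to-1 a (suc t) _ a≤t = ∣ratio-1∣ a t a≤t

A≢1 : (G : Graph) → 1 ≤ n G → Matching (adj G) → ¬ A≡1 G
-- The tolerance ½ already fails: the complement of an independent set always has density at least
-- ½.
A≢1 G 1≤n matching A≡1 with A≡1 ½ (ℚ.*<* (ℤ.+<+ (s≤s z≤n)))
... | k , close = ℚₚ.<-irrefl refl (ℚₚ.<-≤-trans
  (subst (ℚ._< ½) (distance-to-1 (αPow G m) T 1≤T (αPow≤ G m)) (close k ℕₚ.≤-refl))
  (far T 1≤T (αPow-half G matching m)))
  where
  m = suc k
  T = n G ^ m
  1≤T = ^-positive m 1≤n

  far : ∀ t → 1 ≤ t → αPow G m + αPow G m ≤ t → ½ ℚ.≤ ratio (t ∸ αPow G m) t
  far (suc t) _ le = ratio-≤ 1 1 (suc t ∸ a) t (begin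
    1 * suc t                      ≡⟨ ℕₚ.*-identityˡ (suc t) ⟩
    suc t                          ≡⟨ ℕₚ.m∸n+n≡m (ℕₚ.m+n≤o⇒m≤o a le) ⟨
    (suc t ∸ a) + a                ≤⟨ ℕₚ.+-monoʳ-≤ (suc t ∸ a) (ℕₚ.m+n≤o⇒m≤o∸n a le) ⟩
    (suc t ∸ a) + (suc t ∸ a)      ≡⟨ cong ((suc t ∸ a) +_) (ℕₚ.+-identityʳ (suc t ∸ a)) ⟨
    2 * (suc t ∸ a)                ≡⟨ ℕₚ.*-comm 2 (suc t ∸ a) ⟩
    (suc t ∸ a) * 2                ∎)
    where
    open ≤-Reasoning
    a = αPow G m

-- The violator case: an exponential moment bound.

-- Bernoulli's inequality (1 + 1/W)^m ≥ 1 + m/W, multiplied by W^(m+1).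
bernoulli : ∀ W m → (W + m) * W ^ m ≤ W * suc W ^ m
bernoulli W zero    = ℕₚ.≤-reflexive (cong (_* 1) (ℕₚ.+-identityʳ W))
bernoulli W (suc m) = begin
  (W + suc m) * (W * W ^ m)        ≤⟨ ℕₚ.m≤m+n _ (m * W ^ m) ⟩
  (W + suc m) * (W * W ^ m) + m * W ^ m  ≡⟨ expand W m (W ^ m) ⟩
  suc W * ((W + m) * W ^ m)        ≤⟨ ℕₚ.*-monoʳ-≤ (suc W) (bernoulli W m) ⟩
  suc W * (W * suc W ^ m)          ≡⟨ commute (suc W) W (suc W ^ m) ⟩
  W * (suc W * suc W ^ m)          ∎
  where
  open ≤-Reasoning
  expand : ∀ W m p → (W + suc m) * (W * p) + m * p ≡ suc W * ((W + m) * p)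
  expand = solve-∀
  commute : ∀ a b c → a * (b * c) ≡ b * (a * c)
  commute = solve-∀

^-distribʳ-* : ∀ m a b → (a * b) ^ m ≡ a ^ m * b ^ m
^-distribʳ-* zero    a b = refl
^-distribʳ-* (suc m) a b = trans (cong (a * b *_) (^-distribʳ-* m a b)) (interchange-* a b (a ^ m) (b ^ m))
  where
  interchange-* : ∀ a b c d → a * b * (c * d) ≡ a * c * (b * d)
  interchange-* = solve-∀

tally : ∀ {k m} → (Fin k → Bool) → Vec (Fin k) m → ℕ
tally p []      = 0
tally p (u ∷ x) = ⟦ p u ⟧ + tally p x

-- Chernoff: with w = j² on I, k² on N(I) and jk elsewhere (the weights z, 1/z, 1 for z = j/k,
-- scaled by jk), a vertex x of G^m with at least as many coordinates in N(I) as in I has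
-- ∏ w(xᵢ) ≥ (jk)^m, whereas ∑ w < n jk once j = |I| and k = j + 1.
module Chernoff (G : Graph) (violator : Violator G) where
  open Violator violator

  V = allFin (n G)
  N = nbhd (adj G) I
  j = card I
  k = suc j
  D = j * k

  1≤j : 1 ≤ j
  1≤j = ℕₚ.≤-trans (s≤s z≤n) shrinking

  disjoint : ∀ u → I u ≡ true → N u ≡ false
  disjoint u Iu with N u in Nu
  ... | false = refl
  ... | true with nbhd-elim (adj G) I Nu
  ...   | v , Iv , vu = true≢false vu (independent v u Iv Iu)

  weight : Fin (n G) → ℕ
  weight u = if I u then j * j else if N u then k * k else D

  W = ∑ V weight

  -- Since j² = D - j and k² = D + k, the total is W = nD - j|I| + k|N(I)|. With |I| = j and |N(I)|
  -- ≤ j - 1, the correction k|N(I)| ≤ (j + 1)(j - 1) stays below j². In terms of z = j/k: the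
  -- derivative of the normalised sum at z = 1 is |I| - |N(I)| > 0, so a z slightly below 1 is
  -- chosen.
  W<nD : W < n G * D
  W<nD = ℕₚ.+-cancelʳ-< (j * j) W (n G * D) (begin-strict
    W + j * j                                            ≡⟨ cong (W +_) (∑-*ˡ V j (⟦_⟧ ∘ I)) ⟨
    W + ∑ V (λ u → j * ⟦ I u ⟧)                          ≡⟨ ∑-distrib-⊕ V _ _ ⟨
    ∑ V (λ u → weight u + j * ⟦ I u ⟧)                   ≡⟨ ∑-cong V (λ u → pointwise (I u) (N u) (disjoint u)) ⟩
    ∑ V (λ u → D * 1 + k * ⟦ N u ⟧)                      ≡⟨ ∑-distrib-⊕ V _ _ ⟩
    ∑ V (λ _ → D * 1) + ∑ V (λ u → k * ⟦ N u ⟧)          ≡⟨ cong₂ _+_ (∑-*ˡ V D (λ _ → 1)) (∑-*ˡ V k (⟦_⟧ ∘ N)) ⟩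
    D * ∑ V (λ _ → 1) + k * card N                       ≡⟨ cong (_+ k * card N)
      (trans (cong (D *_) (∑-1 (n G))) (ℕₚ.*-comm D (n G))) ⟩
    n G * D + k * card N                                 <⟨ ℕₚ.+-monoʳ-< (n G * D) kN<jj ⟩
    n G * D + j * j                                      ∎)
    where
    open ≤-Reasoning
    case-I : ∀ j → j * j + j * 1 ≡ j * suc j * 1 + suc j * 0
    case-I = solve-∀
    case-N : ∀ j → suc j * suc j + j * 0 ≡ j * suc j * 1 + suc j * 1
    case-N = solve-∀
    case-other : ∀ j → j * suc j + j * 0 ≡ j * suc j * 1 + suc j * 0
    case-other = solve-∀

    pointwise : ∀ a b → (a ≡ true → b ≡ false) →
      (if a then j * j else if b then k * k else D) + j * ⟦ a ⟧ ≡ D * 1 + k * ⟦ b ⟧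
    pointwise true  true  h = true≢false refl (h refl)
    pointwise true  false _ = case-I j
    pointwise false true  _ = case-N j
    pointwise false false _ = case-other j

    kN<jj : k * card N < j * j
    kN<jj = begin-strict
      card N + j * card N  <⟨ ℕₚ.+-monoˡ-< (j * card N) shrinking ⟩
      j + j * card N       ≡⟨ ℕₚ.*-suc j (card N) ⟨
      j * suc (card N)     ≤⟨ ℕₚ.*-monoʳ-≤ j shrinking ⟩
      j * j                ∎

  -- The division-free form of ∏ w = D^m (j/k)^(p - q), where p and q are the tallies of `I` and
  -- N(I).
  ∏-weight : ∀ {m} (x : Vec (Fin (n G)) m) →
    ∏ weight x * (k ^ tally I x * j ^ tally N x) ≡ D ^ m * (j ^ tally I x * k ^ tally N x)
  ∏-weight [] = refl
  ∏-weight {suc m} (u ∷ x) = begin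
    weight u * ∏ weight x * (k ^ (i + tI) * j ^ (b + tN))
      ≡⟨ cong (weight u * ∏ weight x *_) (cong₂ _*_ (ℕₚ.^-distribˡ-+-* k i tI) (ℕₚ.^-distribˡ-+-* j b tN)) ⟩
    weight u * ∏ weight x * (k ^ i * k ^ tI * (j ^ b * j ^ tN))
      ≡⟨ rearrange (weight u) (∏ weight x) (k ^ i) (k ^ tI) (j ^ b) (j ^ tN) ⟩
    weight u * (k ^ i * j ^ b) * (∏ weight x * (k ^ tI * j ^ tN))
      ≡⟨ cong₂ _*_ (step (I u) (N u) (disjoint u)) (∏-weight x) ⟩
    D * (j ^ i * k ^ b) * (D ^ m * (j ^ tI * k ^ tN))
      ≡⟨ sym (rearrange D (D ^ m) (j ^ i) (j ^ tI) (k ^ b) (k ^ tN)) ⟩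
    D * D ^ m * (j ^ i * j ^ tI * (k ^ b * k ^ tN))
      ≡⟨ cong (D * D ^ m *_) (sym (cong₂ _*_ (ℕₚ.^-distribˡ-+-* j i tI) (ℕₚ.^-distribˡ-+-* k b tN))) ⟩
    D * D ^ m * (j ^ (i + tI) * k ^ (b + tN)) ∎
    where
    open ≡-Reasoning
    i  = ⟦ I u ⟧
    b  = ⟦ N u ⟧
    tI = tally I x
    tN = tally N x
    rearrange : ∀ a p q r s t → a * p * (q * r * (s * t)) ≡ a * (q * s) * (p * (r * t))
    rearrange = solve-∀
    case-I : ∀ j → j * j * (suc j * 1 * 1) ≡ j * suc j * (j * 1 * 1)
    case-I = solve-∀
    case-N : ∀ j → suc j * suc j * (1 * (j * 1)) ≡ j * suc j * (1 * (suc j * 1))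
    case-N = solve-∀

    step : ∀ a c → (a ≡ true → c ≡ false) →
      (if a then j * j else if c then k * k else D) * (k ^ ⟦ a ⟧ * j ^ ⟦ c ⟧) ≡ D * (j ^ ⟦ a ⟧ * k ^ ⟦ c ⟧)
    step true  true  h = true≢false refl (h refl)
    step true  false _ = case-I j
    step false true  _ = case-N j
    step false false _ = refl

  good : ∀ {m} → Vec (Fin (n G)) m → Bool
  good x = ⌊ tally N x <? tally I x ⌋

  tally-adjacent : ∀ {m} (x y : Vec (Fin (n G)) m) → powAdj G m x y ≡ true → tally I x ≤ tally N y
  tally-adjacent []      []      _  = z≤n
  tally-adjacent (u ∷ x) (v ∷ y) xy with ∧-elim {adj G u v} xy
  ... | uv , xy′ = ℕₚ.+-mono-≤ (⟦⟧-mono (λ Iu → nbhd-intro (adj G) I Iu uv)) (tally-adjacent x y xy′)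

  powAdj-sym : ∀ {m} (x y : Vec (Fin (n G)) m) → powAdj G m x y ≡ powAdj G m y x
  powAdj-sym []      []      = refl
  powAdj-sym (u ∷ x) (v ∷ y) = cong₂ _∧_ (Defs.sym G u v) (powAdj-sym x y)

  good⇒< : ∀ {m} (x : Vec (Fin (n G)) m) → good x ≡ true → tally N x < tally I x
  good⇒< x h with tally N x <? tally I x
  ... | yes lt = lt
  good⇒< x () | no _

  -- `tally-adjacent` is used along the edge in both directions; with the two strict inequalities it
  -- closes a cycle.
  good-independent : ∀ {m} (x y : Vec (Fin (n G)) m) → good x ≡ true → good y ≡ true → powAdj G m x y ≡ false
  good-independent {m} x y gx gy with powAdj G m x y in xy
  ... | false = refl
  ... | true  = contradiction (begin-strict
    tally N y  <⟨ good⇒< y gy ⟩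
    tally I y  ≤⟨ tally-adjacent y x (trans (powAdj-sym y x) xy) ⟩
    tally N x  <⟨ good⇒< x gx ⟩
    tally I x  ≤⟨ tally-adjacent x y xy ⟩
    tally N y  ∎) (ℕₚ.<-irrefl refl)
    where open ≤-Reasoning

  -- If p ≤ q, the factor (j/k)^(p - q) in `∏-weight` is at least 1, because j < k.
  bad-weight : ∀ {m} (x : Vec (Fin (n G)) m) → D ^ m * ⟦ not (good x) ⟧ ≤ ∏ weight x
  bad-weight {m} x with tally N x <? tally I x
  ... | yes _   = ℕₚ.≤-trans (ℕₚ.≤-reflexive (ℕₚ.*-zeroʳ (D ^ m))) z≤n
  ... | no  N≮I = ℕₚ.≤-trans (ℕₚ.≤-reflexive (ℕₚ.*-identityʳ (D ^ m)))
      (ℕₚ.*-cancelʳ-≤ (D ^ m) (∏ weight x) (k ^ p * j ^ q) {{ℕ.>-nonZero 1≤kᵖjᵠ}} (begin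
        D ^ m * (k ^ p * j ^ q)       ≤⟨ ℕₚ.*-monoʳ-≤ (D ^ m) (exchange (ℕₚ.≮⇒≥ N≮I)) ⟩
        D ^ m * (j ^ p * k ^ q)       ≡⟨ ∏-weight x ⟨
        ∏ weight x * (k ^ p * j ^ q)  ∎))
    where
    open ≤-Reasoning
    p = tally I x
    q = tally N x
    1≤kᵖjᵠ : 1 ≤ k ^ p * j ^ q
    1≤kᵖjᵠ = ℕₚ.*-mono-≤ (^-positive p (s≤s z≤n)) (^-positive q 1≤j)
    regroup : ∀ a b c → a * (b * c) ≡ b * (a * c)
    regroup = solve-∀
    exchange : ∀ {p q} → p ≤ q → k ^ p * j ^ q ≤ j ^ p * k ^ q
    exchange {p} {q} p≤q = subst (λ q → k ^ p * j ^ q ≤ j ^ p * k ^ q) (ℕₚ.m+[n∸m]≡n p≤q) (begin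
      k ^ p * j ^ (p + d)      ≡⟨ cong (k ^ p *_) (ℕₚ.^-distribˡ-+-* j p d) ⟩
      k ^ p * (j ^ p * j ^ d)  ≤⟨ ℕₚ.*-monoʳ-≤ (k ^ p) (ℕₚ.*-monoʳ-≤ (j ^ p) (ℕₚ.^-monoˡ-≤ d (ℕₚ.n≤1+n j))) ⟩
      k ^ p * (j ^ p * k ^ d)  ≡⟨ regroup (k ^ p) (j ^ p) (k ^ d) ⟩
      j ^ p * (k ^ p * k ^ d)  ≡⟨ cong (j ^ p *_) (ℕₚ.^-distribˡ-+-* k p d) ⟨
      j ^ p * k ^ (p + d)      ∎)
      where d = q ∸ p

  bad : ℕ → ℕ
  bad m = ∑ (allVecs (n G) m) (λ x → ⟦ not (good x) ⟧)

  -- By Markov's inequality the bad density is at most (W/nD)^m. Integrality turns W < nD into W + 1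
  -- ≤ nD, and Bernoulli bounds (W/(W+1))^m by W/(W+m).
  bad-rare : ∀ m → bad m * (W + m) ≤ W * n G ^ m
  bad-rare m = ℕₚ.*-cancelˡ-≤ (D ^ m) {{ℕ.>-nonZero (^-positive m (ℕₚ.*-mono-≤ 1≤j (s≤s z≤n)))}} (begin
    D ^ m * (bad m * (W + m))  ≡⟨ regroup (D ^ m) (bad m) (W + m) ⟩
    (W + m) * (D ^ m * bad m)  ≤⟨ ℕₚ.*-monoʳ-≤ (W + m) Markov ⟩
    (W + m) * W ^ m            ≤⟨ bernoulli W m ⟩
    W * suc W ^ m              ≤⟨ ℕₚ.*-monoʳ-≤ W (ℕₚ.^-monoˡ-≤ m W<nD) ⟩
    W * (n G * D) ^ m          ≡⟨ cong (W *_) (^-distribʳ-* m (n G) D) ⟩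
    W * (n G ^ m * D ^ m)      ≡⟨ regroup W (n G ^ m) (D ^ m) ⟩
    D ^ m * (W * n G ^ m)      ∎)
    where
    open ≤-Reasoning
    regroup : ∀ a b c → a * (b * c) ≡ c * (a * b)
    regroup = solve-∀
    Markov : D ^ m * bad m ≤ W ^ m
    Markov = begin
      D ^ m * bad m                                              ≡⟨ ∑-*ˡ (allVecs (n G) m) (D ^ m) _ ⟨
      ∑ (allVecs (n G) m) (λ x → D ^ m * ⟦ not (good x) ⟧)       ≤⟨ ∑-mono (allVecs (n G) m) bad-weight ⟩
      ∑ (allVecs (n G) m) (∏ weight)                             ≡⟨ ∑-∏ (n G) m weight ⟩
      W ^ m                                                      ∎

  all-but-bad : ∀ m → n G ^ m ≤ αPow G m + bad m
  all-but-bad m = begin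
    n G ^ m                                            ≡⟨ ∑-allVecs-1 (n G) m ⟨
    ∑ L (λ _ → 1)                                      ≡⟨ ∑-cong L (λ x → sym (⟦⟧-complement (good x))) ⟩
    ∑ L (λ x → ⟦ good x ⟧ + ⟦ not (good x) ⟧)          ≡⟨ ∑-distrib-⊕ L _ _ ⟩
    ∑ L (⟦_⟧ ∘ good) + bad m                           ≡⟨ cong (_+ bad m) (count≡∑ good L) ⟨
    length goods + bad m
      ≤⟨ ℕₚ.+-monoˡ-≤ (bad m) (αPow-lower G m (filter∈sublists good L) goods-independent) ⟩
    αPow G m + bad m                                   ∎
    where
    open ≤-Reasoning
    L = allVecs (n G) m
    goods = filter (λ x → good x Bool.≟ true) L
    good∈ : ∀ {x} → x ∈ goods → good x ≡ true
    good∈ x∈ = proj₂ (∈-filter⁻ (λ x → good x Bool.≟ true) {xs = L} x∈)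
    goods-independent : independentL (powAdj G m) goods ≡ true
    goods-independent = independentL-intro (powAdj G m) goods
      (λ x y x∈ y∈ → good-independent x y (good∈ x∈) (good∈ y∈))

violator⇒A≡1 : (G : Graph) → 1 ≤ n G → Violator G → A≡1 G
violator⇒A≡1 G 1≤n violator ε 0<ε with positive-numerator ε 0<ε
-- For M = m + 1 with m ≥ Wq, where q is the denominator of `ε`, Wq < W + M. So the bad density, at
-- most W/(W+M), is below 1/q, and 1/q ≤ `ε` since the numerator is positive.
... | p , ↥ε≡ = W * ℚ.↧ₙ ε , close
  where
  open Chernoff G violator
  close : ∀ m → W * ℚ.↧ₙ ε ≤ m → ℚ.∣ iPow G (suc m) ℚ.- 1ℚ ∣ ℚ.< ε
  close m Wq≤m = subst (ℚ._< ε) (sym (distance-to-1 (αPow G M) T 1≤T (αPow≤ G M))) (below T 1≤T small)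
    where
    M = suc m
    T = n G ^ M
    q = ℚ.↧ₙ ε
    r = T ∸ αPow G M
    1≤T = ^-positive M 1≤n

    r≤bad : r ≤ bad M
    r≤bad = ℕₚ.m≤n+o⇒m∸n≤o T (αPow G M) (all-but-bad M)

    small : r * q < suc p * T
    small = ℕₚ.*-cancelʳ-< (W + M) (r * q) (suc p * T) (begin-strict
      r * q * (W + M)      ≤⟨ ℕₚ.*-monoˡ-≤ (W + M) (ℕₚ.*-monoˡ-≤ q r≤bad) ⟩
      bad M * q * (W + M)  ≡⟨ swap (bad M) q (W + M) ⟩
      bad M * (W + M) * q  ≤⟨ ℕₚ.*-monoˡ-≤ q (bad-rare M) ⟩
      W * T * q            ≡⟨ trans (swap W T q) (ℕₚ.*-comm (W * q) T) ⟩
      T * (W * q)          <⟨ ℕₚ.*-monoʳ-< T {{ℕ.>-nonZero 1≤T}} (ℕₚ.≤-trans (s≤s Wq≤m) (ℕₚ.m≤n+m M W)) ⟩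
      T * (W + M)          ≤⟨ ℕₚ.*-monoˡ-≤ (W + M) (ℕₚ.m≤m+n T (p * T)) ⟩
      suc p * T * (W + M)  ∎)
      where
      open ≤-Reasoning
      swap : ∀ a b c → a * b * c ≡ a * c * b
      swap = solve-∀

    below : ∀ t → 1 ≤ t → r * q < suc p * t → ratio r t ℚ.< ε
    below (suc t) _ lt = ratio-< r t (suc p) ε ↥ε≡ lt

theorem2p1 : (G : Graph) → 1 ≤ n G →
    (A≡1 G ⇔ (a* G ≡ 1ℚ)) × ((a* G ≡ 1ℚ) ⇔ (¬ HasFractionalPerfectMatching G))
theorem2p1 G 1≤n with matching-or-violator G
... | inj₁ matching =
      mk⇔ (λ A≡1 → contradiction A≡1 (A≢1 G 1≤n matching)) (λ a*≡1 → contradiction a*≡1 (a*≢1 G matching))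
    , mk⇔ (λ a*≡1 → contradiction a*≡1 (a*≢1 G matching))
          (λ none → contradiction (matching⇒fractional G matching) none)
... | inj₂ violator =
      mk⇔ (λ _ → a*≡1 G violator) (λ _ → violator⇒A≡1 G 1≤n violator)
    , mk⇔ (λ _ → violator⇒¬fractional G violator) (λ _ → a*≡1 G violator)
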